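{- Let $p$ be a prime, $p>3$, and let $t\in D_p$. If $t\not\equiv 0\pmod p$, then modulo $p$: \begin{align*} \sum_{k=1}^{\lfloor p/3\rfloor}C_k^{(2)}\bigl(t^{2}(t+1)\bigr)^k&\equiv \frac{1+t}{2t}-\frac{1-3t}{2t}\left(\frac{(1+t)(1-3t)}{p}\right),\\ \sum_{k=1}^{p-1}C_k^{(2)}\bigl(t^2(t+1)\bigr)^k&\equiv \frac{(1+t)(1-3t)}{2t}\left(1-\left(\frac{(1+t)(1-3t)}{p}\right)\right). \end{align*} If $3t+2\not\equiv 0\pmod p$, then modulo $p$: \begin{align*} \sum_{k=1}^{\lfloor p/3\rfloor}\binom{3k}{k}\bigl(t^2(t+1)\bigr)^k&\equiv \frac{3(t+1)}{2(3t+2)}\left(\left(\frac{(1+t)(1-3t)}{p}\right)-1\right),\\ \sum_{k=1}^{p-1}\binom{3k}{k}\bigl(t^2(t+1)\bigr)^k&\equiv \frac{3(t+1)^2}{2(3t+2)}\left(\left(\frac{(1+t)(1-3t)}{p}\right)-1\right). \end{align*}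
   Context: $C_n^{(2)}=\frac{1}{2n+1}\binom{3n}{n}$. $D_p$ is the set of rationals whose denominator is not divisible by $p$; congruences are in the usual sense. For $c=a/b\in D_p$ in lowest terms, $\left(\frac{c}{p}\right)=\left(\frac{ab}{p}\right)$ (Legendre symbol), which is $0$ if $p\mid a$. -}

module Defs where

open import Data.Nat as ℕ using (ℕ; zero; suc)
open import Data.Nat.Divisibility as ℕD using ()
open import Data.Nat.Combinatorics using (_C_)
open import Data.Integer as ℤ using (ℤ; +_; ∣_∣)
open import Data.Rational as ℚ using (ℚ; 0ℚ; 1ℚ; _+_; _*_; _-_; _÷_; ↥_; ↧ₙ_; ≢-nonZero)
open import Data.Rational.Properties as ℚP using ()
open import Data.List using (List; upTo)
open import Data.Bool.ListAction using (any)
open import Data.Bool using (Bool; if_then_else_)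
open import Relation.Nullary using (¬_; yes; no; does)

InD : ℕ → ℚ → Set
InD p x = ¬ (p ℕD.∣ (↧ₙ x))

infix 4 _≡_[modℚ_]
_≡_[modℚ_] : ℚ → ℚ → ℕ → Set
x ≡ y [modℚ p ] = p ℕD.∣ ∣ ↥ (x - y) ∣

pow : ℚ → ℕ → ℚ
pow x zero = 1ℚ
pow x (suc n) = x * pow x n

sum1 : ℕ → (ℕ → ℚ) → ℚ
sum1 zero f = 0ℚ
sum1 (suc m) f = sum1 m f + f (suc m)

-- total division (only used with nonzero divisor)
div : ℚ → ℚ → ℚ
div x y with y ℚP.≟ 0ℚ
... | yes _ = 0ℚ
... | no y≢0 = _÷_ x y {{≢-nonZero y≢0}}

isSqModb : ℕ → ℤ → Bool
isSqModb p a = any (λ x → does (p ℕD.∣? ∣ (+ x) ℤ.* (+ x) ℤ.- a ∣)) (upTo p)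

legendreℤ : ℕ → ℤ → ℤ
legendreℤ p a with p ℕD.∣? ∣ a ∣
... | yes _ = + 0
... | no _ = if isSqModb p a then + 1 else ℤ.- (+ 1)

-- Legendre symbol of c = a/b ∈ D_p in lowest terms : (ab / p)
legendre : ℚ → ℕ → ℚ
legendre c p = ℚ._/_ (legendreℤ p ((↥ c) ℤ.* (+ (↧ₙ c)))) 1

C2 : ℕ → ℚ
C2 k = ℚ._/_ (+ ((3 ℕ.* k) C k)) (suc (2 ℕ.* k))

binom3 : ℕ → ℚ
binom3 k = ℚ._/_ (+ ((3 ℕ.* k) C k)) 1

q : ℕ → ℚ
q n = ℚ._/_ (+ n) 1

{-# OPTIONS --safe #-}

-- Put x = t²(t+1) and F(y) = Σ_{k<p} x^k y^(p-1-k) (1+y)^(3k).  The sum telescopes: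
-- (x(1+y)³ - y) F(y) = x^p (1+y)^(3p) - y^p ≡ x(1+y^p)³ - y^p (mod p), and
-- x(1+y)³ - y = L·Q with L = (t+1) + ty and Q a quadratic of discriminant
-- D = (1+t)(1-3t).  Hence the coefficients of G = Q·F satisfy a first order and those
-- of H = L·F a second order linear recurrence, homogeneous except at multiples of p.
-- Fermat's theorem solves the former; for the latter the Frobenius map gives the
-- values around indices p and 2p in terms of D^((p-1)/2) ≡ (D/p).  The full sums are
-- the coefficients of F at p-1 and p-2; since C(3k, k+p) ≡ C(3k, k) for p ≤ 3k < 3p,
-- the sums up to p/3 are obtained by subtracting those at 2p-1 and 2p-2.  The
-- resultant of L and Q is 3t+2, which is where this denominator comes from, and
-- C_k^(2) = C(3k, k) - 2 C(3k, k-1) gives the Catalan sums.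

module Submission where

open import Defs
open import Data.Nat as ℕ using (ℕ; zero; suc; _∸_; _>_; z≤n; s≤s)
import Data.Nat.Properties as ℕP
import Data.Nat.Divisibility as ℕD
import Data.Nat.DivMod as ℕDM
import Data.Nat.Tactic.RingSolver as ℕR
open import Data.Nat.Combinatorics using (_C_; nC1≡n; nCn≡1; k>n⇒nCk≡0; nCk+nC[k+1]≡[n+1]C[k+1])
open import Data.Nat.Primality using (Prime; euclidsLemma; prime⇒nonZero; prime⇒nonTrivial; prime⇒irreducible)
open import Data.Integer as Int using (ℤ; +_; ∣_∣)
import Data.Integer.Properties as ℤP
import Data.Integer.DivMod as ℤDM
open import Data.Integer.Divisibility.Signed using (divides; ∣ᵤ⇒∣; ∣⇒∣ᵤ; ∣m∣n⇒∣m+n; ∣n⇒∣m*n) renaming (_∣_ to _∣ℤ_)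
open import Data.Integer.Tactic.RingSolver using (solve-∀)
open import Data.Rational as Rat using (ℚ; 0ℚ; 1ℚ)
import Data.Rational.Properties as ℚP
import Data.Rational.Unnormalised as ℚᵘ
import Data.Rational.Unnormalised.Properties as ℚᵘP
import Data.Rational.Solver
open import Data.Bool using (true; false; T)
open import Data.Empty using (⊥; ⊥-elim; ⊥-elim-irr)
open import Data.List using (upTo)
open import Data.List.Relation.Unary.Any.Properties using (any⁺; any⁻)
open import Data.List.Membership.Propositional using (find; lose)
open import Data.List.Membership.Propositional.Properties using (∈-upTo⁺; ∈-upTo⁻)
open import Data.Product using (_×_; _,_; ∃; proj₁; proj₂)
open import Data.Sum using (_⊎_; inj₁; inj₂; [_,_]′)
open import Data.Vec using (Vec; []; _∷_)
open import Relation.Nullary using (¬_; Dec; yes; no)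
open import Relation.Nullary.Decidable using (toWitness; fromWitness; isYes≗does)
open import Relation.Binary.Bundles using (Setoid)
open import Relation.Binary.PropositionalEquality using (_≡_; refl; sym; trans; cong; cong₂; subst; module ≡-Reasoning)
import Relation.Binary.Reasoning.Setoid

-- The variable t is replaced by an integer with the same residue, and each value is stated after
-- multiplication by its denominators; division only ever means cancelling a factor prime to p. The
-- number C_k^(2) is given as a fraction with denominator 2k + 1, which p divides at k = (p-1)/2;
-- its expression through two binomial coefficients shows that it is an integer and removes this
-- obstacle. The recurrences can be solved for their leading terms, and run backwards, when t and t
-- + 1 are invertible modulo p. In the remaining cases x ≡ 0, so every sum vanishes and the
-- right-hand sides are checked directly. The Catalan congruences survive p | 3t + 2: since t (1 -
-- 2y) = (3t + 2) - 2L, the combination of neighbouring coefficients that they require involves F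
-- only through (3t + 2) F. The power E = D^((p-1)/2) is carried along instead of the symbol,
-- because D E² ≡ D also covers the case p | D.

module ℚS = Data.Rational.Solver.+-*-Solver

-- Finite sums of integers.

module Sums where
  open Int using (_+_; _*_; _-_; -_)

  Σ< : ℕ → (ℕ → ℤ) → ℤ
  Σ< zero    f = + 0
  Σ< (suc n) f = Σ< n f + f n

  Σ<-cong : ∀ n {f g} → (∀ k → k ℕ.< n → f k ≡ g k) → Σ< n f ≡ Σ< n g
  Σ<-cong zero    f≗g = refl
  Σ<-cong (suc n) f≗g = cong₂ _+_ (Σ<-cong n (λ k k<n → f≗g k (ℕP.m<n⇒m<1+n k<n))) (f≗g n ℕP.≤-refl)

  Σ<-head : ∀ n f → Σ< (suc n) f ≡ f 0 + Σ< n (λ k → f (suc k))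
  Σ<-head zero    f = ℤP.+-comm (+ 0) (f 0)
  Σ<-head (suc n) f = trans (cong (_+ f (suc n)) (Σ<-head n f)) (ℤP.+-assoc (f 0) _ _)

  Σ<-+ : ∀ n f g → Σ< n (λ k → f k + g k) ≡ Σ< n f + Σ< n g
  Σ<-+ zero    f g = refl
  Σ<-+ (suc n) f g = trans (cong (_+ (f n + g n)) (Σ<-+ n f g)) (rearrange (Σ< n f) (Σ< n g) (f n) (g n))
    where
    rearrange : ∀ a b c d → a + b + (c + d) ≡ (a + c) + (b + d)
    rearrange = solve-∀

  Σ<-* : ∀ n c f → Σ< n (λ k → c * f k) ≡ c * Σ< n f
  Σ<-* zero    c f = sym (ℤP.*-zeroʳ c)
  Σ<-* (suc n) c f = trans (cong (_+ c * f n) (Σ<-* n c f)) (sym (ℤP.*-distribˡ-+ c (Σ< n f) (f n)))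

  Σ<-telescope : ∀ n f → Σ< n (λ k → f (suc k)) - Σ< n f ≡ f n - f 0
  Σ<-telescope n f = trans (rearrange (f 0) (Σ< n (λ k → f (suc k))) (Σ< n f))
      (trans (cong (λ s → s - f 0 - Σ< n f) (sym (Σ<-head n f))) (cancel (Σ< n f) (f n) (f 0)))
    where
    rearrange : ∀ a s r → s - r ≡ a + s - a - r
    rearrange = solve-∀
    cancel : ∀ s a b → s + a - b - s ≡ a - b
    cancel = solve-∀

open Sums

-- Binomial coefficients and powers of b + E for the shift operator E.

module Binomials where
  open Int using (_+_; _*_; _-_; -_; _^_)

  choose : ℕ → ℕ → ℤ
  choose n k = + (n C k)

  pascal : ∀ n k → choose (suc n) (suc k) ≡ choose n k + choose n (suc k)
  pascal n k = trans (cong +_ (sym (nCk+nC[k+1]≡[n+1]C[k+1] n k))) (ℤP.pos-+ (n C k) _)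

  choose-zero : ∀ {n k} → n ℕ.< k → choose n k ≡ + 0
  choose-zero n<k = cong +_ (k>n⇒nCk≡0 n<k)

  -- Free of division, so that it can be read modulo p: it yields both p | C(p, k) and the
  -- integrality of the Catalan numbers.
  absorption : ∀ n k → + suc k * choose (suc n) (suc k) ≡ + suc n * choose n k
  absorption n zero =
    trans (ℤP.*-identityˡ _) (trans (cong +_ (nC1≡n (suc n))) (sym (ℤP.*-identityʳ (+ suc n))))
  absorption zero (suc k) =
    trans (cong (+ suc (suc k) *_) (choose-zero {1} {suc (suc k)} (s≤s (s≤s z≤n))))
      (trans (ℤP.*-zeroʳ (+ suc (suc k))) (sym (trans (ℤP.*-identityˡ _) (choose-zero {0} {suc k} (s≤s z≤n)))))
  absorption (suc n) (suc k) = begin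
    + suc (suc k) * choose (suc (suc n)) (suc (suc k))
      ≡⟨ cong (+ suc (suc k) *_) (pascal (suc n) (suc k)) ⟩
    + suc (suc k) * (choose (suc n) (suc k) + choose (suc n) (suc (suc k)))
      ≡⟨ split (+ suc k) (choose (suc n) (suc k)) (choose (suc n) (suc (suc k))) ⟩
    + suc k * choose (suc n) (suc k) + choose (suc n) (suc k) + + suc (suc k) * choose (suc n) (suc (suc k))
      ≡⟨ cong₂ (λ u v → u + choose (suc n) (suc k) + v) (absorption n k) (absorption n (suc k)) ⟩
    + suc n * choose n k + choose (suc n) (suc k) + + suc n * choose n (suc k)
      ≡⟨ collect (+ suc n) (choose n k) (choose n (suc k)) (choose (suc n) (suc k)) ⟩
    + suc n * (choose n k + choose n (suc k)) + choose (suc n) (suc k)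
      ≡⟨ cong (λ u → + suc n * u + choose (suc n) (suc k)) (sym (pascal n k)) ⟩
    + suc n * choose (suc n) (suc k) + choose (suc n) (suc k)
      ≡⟨ unsplit (+ suc n) (choose (suc n) (suc k)) ⟩
    + suc (suc n) * choose (suc n) (suc k) ∎
    where
    open ≡-Reasoning
    split : ∀ a b c → (+ 1 + a) * (b + c) ≡ a * b + b + (+ 1 + a) * c
    split = solve-∀
    collect : ∀ a b c d → a * b + d + a * c ≡ a * (b + c) + d
    collect = solve-∀
    unsplit : ∀ a b → a * b + b ≡ (+ 1 + a) * b
    unsplit = solve-∀

  -- For a sequence e, (b + E)ⁿ e where E is the shift operator.
  shiftPow : ℤ → ℕ → (ℕ → ℤ) → ℕ → ℤ
  shiftPow b zero    e i = e i
  shiftPow b (suc n) e i = shiftPow b n (λ j → b * e j + e (suc j)) i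

  -- The binomial theorem, valid because the scalar b commutes with E.
  shiftPow-expand : ∀ b n e i →
    shiftPow b n e i ≡ Σ< (suc n) (λ k → choose n k * (b ^ (n ∸ k) * e (i ℕ.+ k)))
  shiftPow-expand b zero e i =
    trans (cong e (sym (ℕP.+-identityʳ i))) (unit (e (i ℕ.+ 0)))
    where
    unit : ∀ a → a ≡ + 0 + + 1 * (+ 1 * a)
    unit = solve-∀
  shiftPow-expand b (suc n) e i = begin
    shiftPow b n (λ j → b * e j + e (suc j)) i
      ≡⟨ shiftPow-expand b n (λ j → b * e j + e (suc j)) i ⟩
    Σ< (suc n) (λ k → choose n k * (b ^ (n ∸ k) * (b * e (i ℕ.+ k) + e (suc (i ℕ.+ k)))))
      ≡⟨ Σ<-cong (suc n) (λ k k<1+n → trans (distrib (choose n k) (b ^ (n ∸ k)) b (e (i ℕ.+ k)) (e (suc (i ℕ.+ k))))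
           (cong₂ (λ u v → choose n k * (u * e (i ℕ.+ k)) + choose n k * (b ^ (n ∸ k) * v))
             (cong (b ^_) (sym (ℕP.+-∸-assoc 1 (ℕP.≤-pred k<1+n)))) (cong e (sym (ℕP.+-suc i k))))) ⟩
    Σ< (suc n) (λ k → A k + B k)
      ≡⟨ Σ<-+ (suc n) A B ⟩
    Σ< (suc n) A + Σ< (suc n) B
      -- The zero term `A (suc n)` is appended so that, once `A 0` is split off, the two sums have
      -- the same range and Pascal's rule joins them termwise.
      ≡⟨ cong (_+ Σ< (suc n) B) (trans (sym (ℤP.+-identityʳ (Σ< (suc n) A))) (cong (λ u → Σ< (suc n) A + u) (sym A-last))) ⟩
    Σ< (suc (suc n)) A + Σ< (suc n) B
      ≡⟨ cong (_+ Σ< (suc n) B) (Σ<-head (suc n) A) ⟩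
    A 0 + Σ< (suc n) (λ k → A (suc k)) + Σ< (suc n) B
      ≡⟨ ℤP.+-assoc (A 0) _ _ ⟩
    A 0 + (Σ< (suc n) (λ k → A (suc k)) + Σ< (suc n) B)
      ≡⟨ cong (λ u → A 0 + u) (trans (sym (Σ<-+ (suc n) (λ k → A (suc k)) B))
           (Σ<-cong (suc n) (λ k _ → trans (factor (choose n (suc k)) (choose n k) (b ^ (n ∸ k) * e (i ℕ.+ suc k)))
             (cong (_* (b ^ (n ∸ k) * e (i ℕ.+ suc k))) (sym (pascal n k)))))) ⟩
    R 0 + Σ< (suc n) (λ k → R (suc k))
      ≡⟨ Σ<-head (suc n) R ⟨
    Σ< (suc (suc n)) R ∎
    where
    open ≡-Reasoning
    A B R : ℕ → ℤ
    A k = choose n k * (b ^ (suc n ∸ k) * e (i ℕ.+ k))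
    B k = choose n k * (b ^ (n ∸ k) * e (i ℕ.+ suc k))
    R k = choose (suc n) k * (b ^ (suc n ∸ k) * e (i ℕ.+ k))
    A-last : A (suc n) ≡ + 0
    A-last = trans (cong (_* (b ^ (n ∸ n) * e (i ℕ.+ suc n))) (choose-zero (ℕP.n<1+n n)))
                   (ℤP.*-zeroˡ (b ^ (n ∸ n) * e (i ℕ.+ suc n)))
    distrib : ∀ c u b x y → c * (u * (b * x + y)) ≡ c * ((b * u) * x) + c * (u * y)
    distrib = solve-∀
    factor : ∀ a b c → a * c + b * c ≡ (b + a) * c
    factor = solve-∀

  -- A geometric sequence is an eigenvector of E with eigenvalue a. The induction needs an arbitrary
  -- scalar multiple `c`, because `shiftPow` recurses on the sequence.
  shiftPow-geometric : ∀ b a n i → shiftPow b n (a ^_) i ≡ (b + a) ^ n * a ^ i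
  shiftPow-geometric b a n i = trans (go n (a ^_) {+ 1} (λ j → sym (ℤP.*-identityˡ (a ^ j))))
    (cong ((b + a) ^ n *_) (ℤP.*-identityˡ (a ^ i)))
    where
    go : ∀ n e {c} → (∀ j → e j ≡ c * a ^ j) → shiftPow b n e i ≡ (b + a) ^ n * (c * a ^ i)
    go zero    e {c} eq = trans (eq i) (sym (ℤP.*-identityˡ (c * a ^ i)))
    go (suc n) e {c} eq = trans
      (go n (λ j → b * e j + e (suc j)) {(b + a) * c}
        (λ j → trans (cong₂ (λ u v → b * u + v) (eq j) (eq (suc j))) (step a b c (a ^ j))))
      (regroup (b + a) ((b + a) ^ n) c (a ^ i))
      where
      step : ∀ a b c u → b * (c * u) + c * (a * u) ≡ (b + a) * c * u
      step = solve-∀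
      regroup : ∀ s u c v → u * (s * c * v) ≡ s * u * (c * v)
      regroup = solve-∀

  -- If E² = d, then b + E is a root of X² - 2bX + b² - d. Applying b + E preserves the hypothesis
  -- on the sequence, which drives the induction.
  shiftPow-quadratic : ∀ b d n e i → (∀ j → e (suc (suc j)) ≡ d * e j) →
    shiftPow b (suc (suc n)) e i ≡ + 2 * b * shiftPow b (suc n) e i + (d - b * b) * shiftPow b n e i
  shiftPow-quadratic b d zero e i rec =
    trans (cong (λ u → b * (b * e i + e (suc i)) + (b * e (suc i) + u)) (rec i)) (expand b d (e i) (e (suc i)))
    where
    expand : ∀ b d x y → b * (b * x + y) + (b * y + d * x) ≡ + 2 * b * (b * x + y) + (d - b * b) * x
    expand = solve-∀
  shiftPow-quadratic b d (suc n) e i rec =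
    shiftPow-quadratic b d n (λ j → b * e j + e (suc j)) i
      (λ j → trans (cong₂ (λ u v → b * u + v) (rec j) (rec (suc j))) (factor b d (e j) (e (suc j))))
    where
    factor : ∀ b d x y → b * (d * x) + d * y ≡ d * (b * x + y)
    factor = solve-∀

open Binomials

-- Congruence of integers modulo p.

module Congruence (p : ℕ) where
  open Int using (_+_; _*_; _-_; -_; _^_)

  infix 4 _≈_
  -- A record rather than a synonym, because the difference alone does not let unification recover
  -- `a` and `b`.
  record _≈_ (a b : ℤ) : Set where
    constructor mod
    field divisible : + p ∣ℤ a - b
  open _≈_ public

  private variable
    a b c d x y : ℤ

  infixl 6 _⊞_
  infix  7 _⊙_

  _⊙_ : ∀ c → x ≈ y → c * (x - y) ≈ + 0
  c ⊙ mod h = mod (subst (+ p ∣ℤ_) (sym (ℤP.+-identityʳ _)) (∣n⇒∣m*n c h))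

  _⊞_ : a ≈ + 0 → b ≈ + 0 → a + b ≈ + 0
  _⊞_ {a} {b} (mod h) (mod h′) = mod (subst (+ p ∣ℤ_) (identity a b) (∣m∣n⇒∣m+n h h′))
    where
    identity : ∀ a b → a - + 0 + (b - + 0) ≡ a + b - + 0
    identity = solve-∀

  -- Proves a ≈ b by a ring identity expressing a - b as a linear combination
  -- of the differences of known congruences, as in  by (c ⊙ h ⊞ c′ ⊙ h′) eq.
  by : c ≈ + 0 → a - b ≡ c → a ≈ b
  by (mod h) eq = mod (subst (+ p ∣ℤ_) (trans (ℤP.+-identityʳ _) (sym eq)) h)

  ≈-reflexive : a ≡ b → a ≈ b
  ≈-reflexive {a} refl = mod (divides (+ 0) (ℤP.+-inverseʳ a))

  ≈-refl : a ≈ a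
  ≈-refl = ≈-reflexive refl

  ≈-sym : a ≈ b → b ≈ a
  ≈-sym {a} {b} h = by ((- + 1) ⊙ h) (identity a b)
    where
    identity : ∀ a b → b - a ≡ (- + 1) * (a - b)
    identity = solve-∀

  ≈-trans : a ≈ b → b ≈ c → a ≈ c
  ≈-trans {a} {b} {c} h h′ = by ((+ 1) ⊙ h ⊞ (+ 1) ⊙ h′) (identity a b c)
    where
    identity : ∀ a b c → a - c ≡ + 1 * (a - b) + + 1 * (b - c)
    identity = solve-∀

  ≈-setoid : Setoid _ _
  ≈-setoid = record { Carrier = ℤ ; _≈_ = _≈_
    ; isEquivalence = record { refl = ≈-refl ; sym = ≈-sym ; trans = ≈-trans } }

  module ≈-Reasoning = Relation.Binary.Reasoning.Setoid ≈-setoid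

  +-cong : a ≈ b → c ≈ d → a + c ≈ b + d
  +-cong {a} {b} {c} {d} h h′ = by ((+ 1) ⊙ h ⊞ (+ 1) ⊙ h′) (identity a b c d)
    where
    identity : ∀ a b c d → (a + c) - (b + d) ≡ + 1 * (a - b) + + 1 * (c - d)
    identity = solve-∀

  minus-cong : a ≈ b → c ≈ d → a - c ≈ b - d
  minus-cong {a} {b} {c} {d} h h′ = by ((+ 1) ⊙ h ⊞ (- + 1) ⊙ h′) (identity a b c d)
    where
    identity : ∀ a b c d → (a - c) - (b - d) ≡ + 1 * (a - b) + (- + 1) * (c - d)
    identity = solve-∀

  *-cong : a ≈ b → c ≈ d → a * c ≈ b * d
  *-cong {a} {b} {c} {d} h h′ = by (c ⊙ h ⊞ b ⊙ h′) (identity a b c d)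
    where
    identity : ∀ a b c d → a * c - b * d ≡ c * (a - b) + b * (c - d)
    identity = solve-∀

  *-congˡ : ∀ c → a ≈ b → c * a ≈ c * b
  *-congˡ c h = *-cong (≈-refl {c}) h

  *-congʳ : ∀ c → a ≈ b → a * c ≈ b * c
  *-congʳ c h = *-cong h (≈-refl {c})

  +-congˡ : ∀ c → a ≈ b → c + a ≈ c + b
  +-congˡ c h = +-cong (≈-refl {c}) h

  +-congʳ : ∀ c → a ≈ b → a + c ≈ b + c
  +-congʳ c h = +-cong h (≈-refl {c})

  ^-cong : ∀ n → a ≈ b → a ^ n ≈ b ^ n
  ^-cong zero    h = ≈-refl
  ^-cong (suc n) h = *-cong h (^-cong n h)

  Σ<-cong-≈ : ∀ n {f g} → (∀ k → k ℕ.< n → f k ≈ g k) → Σ< n f ≈ Σ< n g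
  Σ<-cong-≈ zero    f≈g = ≈-refl
  Σ<-cong-≈ (suc n) f≈g = +-cong (Σ<-cong-≈ n (λ k k<n → f≈g k (ℕP.m<n⇒m<1+n k<n))) (f≈g n ℕP.≤-refl)

  Σ<-zero : ∀ n → Σ< n (λ _ → + 0) ≡ + 0
  Σ<-zero zero    = refl
  Σ<-zero (suc n) = cong (_+ + 0) (Σ<-zero n)

  p≈0 : + p ≈ + 0
  p≈0 = mod (divides (+ 1) (trans (ℤP.+-identityʳ (+ p)) (sym (ℤP.*-identityˡ (+ p)))))

  ∣⇒≈0 : p ℕD.∣ ∣ a ∣ → a ≈ + 0
  ∣⇒≈0 {a} h = mod (subst (+ p ∣ℤ_) (sym (ℤP.+-identityʳ a)) (∣ᵤ⇒∣ h))

  ≈0⇒∣ : a ≈ + 0 → p ℕD.∣ ∣ a ∣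
  ≈0⇒∣ {a} (mod h) = subst (λ x → p ℕD.∣ ∣ x ∣) (ℤP.+-identityʳ a) (∣⇒∣ᵤ h)

  ≈⇒-≈0 : a ≈ b → a - b ≈ + 0
  ≈⇒-≈0 {a} {b} h = by ((+ 1) ⊙ h) (identity a b)
    where
    identity : ∀ a b → a - b - + 0 ≡ + 1 * (a - b)
    identity = solve-∀

  -≈0⇒≈ : a - b ≈ + 0 → a ≈ b
  -≈0⇒≈ {a} {b} h = by ((+ 1) ⊙ h) (identity a b)
    where
    identity : ∀ a b → a - b ≡ + 1 * (a - b - + 0)
    identity = solve-∀

-- Prime modulus: the Frobenius identity, Fermat's theorem and binomial coefficients modulo p.

module PrimeCongruence (p : ℕ) (p-prime : Prime p) where
  open Int using (_+_; _*_; _-_; -_; _^_)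
  open Congruence p public

  private variable
    a b : ℤ

  private instance
    p-nonZero = prime⇒nonZero p-prime

  1<p : 1 ℕ.< p
  1<p = ℕ.nonTrivial⇒n>1 p {{prime⇒nonTrivial p-prime}}

  *≈0 : ∀ a b → a * b ≈ + 0 → a ≈ + 0 ⊎ b ≈ + 0
  *≈0 a b h with euclidsLemma ∣ a ∣ ∣ b ∣ p-prime (subst (p ℕD.∣_) (ℤP.abs-* a b) (≈0⇒∣ h))
  ... | inj₁ l = inj₁ (∣⇒≈0 l)
  ... | inj₂ r = inj₂ (∣⇒≈0 r)

  *≉0 : ¬ a ≈ + 0 → ¬ b ≈ + 0 → ¬ a * b ≈ + 0
  *≉0 {a} {b} a≉0 b≉0 h = [ a≉0 , b≉0 ]′ (*≈0 a b h)

  *-cancelˡ : ∀ c a b → ¬ c ≈ + 0 → c * a ≈ c * b → a ≈ b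
  *-cancelˡ c a b c≉0 h = [ (λ c≈0 → ⊥-elim (c≉0 c≈0)) , -≈0⇒≈ ]′
      (*≈0 c (a - b) (by ((+ 1) ⊙ h) (identity a b c)))
    where
    identity : ∀ a b c → c * (a - b) - + 0 ≡ + 1 * (c * a - c * b)
    identity = solve-∀

  +n≉0 : ∀ {n} → 0 ℕ.< n → n ℕ.< p → ¬ + n ≈ + 0
  +n≉0 {suc n} _ n<p h = ℕP.<⇒≱ n<p (ℕD.∣⇒≤ (≈0⇒∣ h))

  _≈0? : ∀ a → Dec (a ≈ + 0)
  a ≈0? with p ℕD.∣? ∣ a ∣
  ... | yes h = yes (∣⇒≈0 h)
  ... | no ¬h = no (λ h → ¬h (≈0⇒∣ h))

  residue : ∀ a → ∃ λ n → n ℕ.< p × a ≈ + n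
  residue a = a ℤDM.%ℕ p , ℤDM.n%ℕd<d a p ,
    mod (divides (a ℤDM./ℕ p) (trans (cong (_- + (a ℤDM.%ℕ p)) (ℤDM.a≡a%ℕn+[a/ℕn]*n a p))
      (cancel (+ (a ℤDM.%ℕ p)) (a ℤDM./ℕ p * + p))))
    where
    cancel : ∀ x y → x + y - x ≡ y
    cancel = solve-∀

  -- By `absorption`, k C(p, k) = p C(p-1, k-1), and p does not divide k.
  choose-p≈0 : ∀ k → 0 ℕ.< k → k ℕ.< p → choose p k ≈ + 0
  choose-p≈0 (suc k) _ k<p =
    [ (λ h → ⊥-elim (+n≉0 (s≤s z≤n) k<p h)) , (λ h → h) ]′ (*≈0 (+ suc k) (choose p (suc k)) (begin
      + suc k * choose p (suc k)      ≡⟨ subst (λ q → + suc k * choose q (suc k) ≡ + q * choose (ℕ.pred p) k)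
                                           (ℕP.suc-pred p) (absorption (ℕ.pred p) k) ⟩
      + p * choose (ℕ.pred p) k       ≈⟨ *-congʳ (choose (ℕ.pred p) k) p≈0 ⟩
      + 0 * choose (ℕ.pred p) k       ≡⟨ ℤP.*-zeroˡ (choose (ℕ.pred p) k) ⟩
      + 0                             ∎))
    where open ≈-Reasoning

  -- The Frobenius identity (b + E)^p ≡ b^p + E^p, evaluated at index 0.
  shiftPow-p : ∀ b e → shiftPow b p e 0 ≈ b ^ p * e 0 + e p
  shiftPow-p b e = begin
    shiftPow b p e 0                        ≡⟨ shiftPow-expand b p e 0 ⟩
    Σ< (suc p) term                         ≡⟨⟩
    Σ< p term + term p                      ≡⟨ cong (λ q → Σ< q term + term p) (sym (ℕP.suc-pred p)) ⟩
    Σ< (suc (ℕ.pred p)) term + term p       ≡⟨ cong (_+ term p) (Σ<-head (ℕ.pred p) term) ⟩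
    term 0 + Σ< (ℕ.pred p) (λ k → term (suc k)) + term p
      ≈⟨ +-congʳ (term p) (+-congˡ (term 0) (Σ<-cong-≈ (ℕ.pred p) inner)) ⟩
    term 0 + Σ< (ℕ.pred p) (λ _ → + 0) + term p
      ≡⟨ cong₂ (λ u v → term 0 + u + v) (Σ<-zero (ℕ.pred p)) last ⟩
    + 1 * (b ^ p * e 0) + + 0 + e p         ≡⟨ simplify (b ^ p * e 0) (e p) ⟩
    b ^ p * e 0 + e p                       ∎
    where
    open ≈-Reasoning
    term : ℕ → ℤ
    term k = choose p k * (b ^ (p ∸ k) * e k)
    inner : ∀ k → k ℕ.< ℕ.pred p → term (suc k) ≈ + 0
    inner k k<p-1 = ≈-trans
      (*-congʳ (b ^ (p ∸ suc k) * e (suc k))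
        (choose-p≈0 (suc k) (s≤s z≤n) (subst (suc k ℕ.<_) (ℕP.suc-pred p) (s≤s k<p-1))))
      (≈-reflexive (ℤP.*-zeroˡ (b ^ (p ∸ suc k) * e (suc k))))
    last : term p ≡ e p
    last = trans (cong₂ (λ u v → + u * (b ^ v * e p)) (nCn≡1 p) (ℕP.n∸n≡0 p)) (unit (e p))
      where
      unit : ∀ a → + 1 * (+ 1 * a) ≡ a
      unit = solve-∀
    simplify : ∀ a b → + 1 * a + + 0 + b ≡ a + b
    simplify = solve-∀

  -- The Frobenius identity for the sequence of powers of n with b = 1 reads (1 + n)^p ≡ 1 + n^p.
  fermat-ℕ : ∀ n → (+ n) ^ p ≈ + n
  fermat-ℕ zero = ≈-reflexive (subst (λ q → (+ 0) ^ q ≡ + 0) (ℕP.suc-pred p) (ℤP.*-zeroˡ ((+ 0) ^ ℕ.pred p)))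
  fermat-ℕ (suc n) = begin
    (+ 1 + + n) ^ p                        ≡⟨ ℤP.*-identityʳ ((+ 1 + + n) ^ p) ⟨
    (+ 1 + + n) ^ p * + 1                  ≡⟨ shiftPow-geometric (+ 1) (+ n) p 0 ⟨
    shiftPow (+ 1) p ((+ n) ^_) 0          ≈⟨ shiftPow-p (+ 1) ((+ n) ^_) ⟩
    (+ 1) ^ p * + 1 + (+ n) ^ p            ≡⟨ cong (_+ (+ n) ^ p) (trans (ℤP.*-identityʳ ((+ 1) ^ p)) (ℤP.^-zeroˡ p)) ⟩
    + 1 + (+ n) ^ p                        ≈⟨ +-congˡ (+ 1) (fermat-ℕ n) ⟩
    + 1 + + n                              ∎
    where open ≈-Reasoning

  fermat : ∀ a → a ^ p ≈ a
  fermat a with residue a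
  ... | n , _ , a≈n = ≈-trans (^-cong p a≈n) (≈-trans (fermat-ℕ n) (≈-sym a≈n))

  -- The coefficient of y^j in (1+y)^(p+m) ≡ (1 + y^p)(1+y)^m, to which y^p contributes nothing
  -- below degree p.
  choose-p+-low : ∀ m j → j ℕ.< p → choose (p ℕ.+ m) j ≈ choose m j
  choose-p+-low m zero j<p = ≈-refl
  choose-p+-low zero (suc j) j<p = ≈-trans
    (≈-reflexive (cong (λ q → choose q (suc j)) (ℕP.+-identityʳ p)))
    (≈-trans (choose-p≈0 (suc j) (s≤s z≤n) j<p) (≈-reflexive (sym (choose-zero {0} {suc j} (s≤s z≤n)))))
  choose-p+-low (suc m) (suc j) j<p = begin
    choose (p ℕ.+ suc m) (suc j)                       ≡⟨ cong (λ q → choose q (suc j)) (ℕP.+-suc p m) ⟩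
    choose (suc (p ℕ.+ m)) (suc j)                     ≡⟨ pascal (p ℕ.+ m) j ⟩
    choose (p ℕ.+ m) j + choose (p ℕ.+ m) (suc j)      ≈⟨ +-cong (choose-p+-low m j (ℕP.<-trans (ℕP.n<1+n j) j<p)) (choose-p+-low m (suc j) j<p) ⟩
    choose m j + choose m (suc j)                      ≡⟨ pascal m j ⟨
    choose (suc m) (suc j)                             ∎
    where open ≈-Reasoning

  -- The coefficient of y^(p+j) in (1+y)^(p+m) ≡ (1 + y^p)(1+y)^m.
  choose-p+-high : ∀ m j → choose (p ℕ.+ m) (p ℕ.+ j) ≈ choose m (p ℕ.+ j) + choose m j
  choose-p+-high zero zero = ≈-reflexive (begin
    choose (p ℕ.+ 0) (p ℕ.+ 0)     ≡⟨ cong +_ (nCn≡1 (p ℕ.+ 0)) ⟩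
    + 0 + + 1                      ≡⟨ cong (_+ + 1) (choose-zero {0} {p ℕ.+ 0} (ℕP.<-≤-trans (ℕP.<-trans (s≤s z≤n) 1<p) (ℕP.m≤m+n p 0))) ⟨
    choose 0 (p ℕ.+ 0) + + 1       ∎)
    where open ≡-Reasoning
  choose-p+-high zero (suc j) = ≈-reflexive (trans
    (choose-zero (subst (ℕ._< p ℕ.+ suc j) (sym (ℕP.+-identityʳ p)) (ℕP.m<m+n p (s≤s z≤n))))
    (sym (cong₂ _+_ (choose-zero {0} {p ℕ.+ suc j} (ℕP.≤-trans (s≤s z≤n) (ℕP.m≤n+m (suc j) p))) (choose-zero {0} {suc j} (s≤s z≤n)))))
  choose-p+-high (suc m) j = begin
    choose (p ℕ.+ suc m) (p ℕ.+ j)                             ≡⟨ cong₂ choose (ℕP.+-suc p m) p+j≡ ⟩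
    choose (suc (p ℕ.+ m)) (suc (r ℕ.+ j))                     ≡⟨ pascal (p ℕ.+ m) (r ℕ.+ j) ⟩
    choose (p ℕ.+ m) (r ℕ.+ j) + choose (p ℕ.+ m) (suc (r ℕ.+ j))
      ≡⟨ cong (λ q → choose (p ℕ.+ m) (r ℕ.+ j) + choose (p ℕ.+ m) q) (sym p+j≡) ⟩
    choose (p ℕ.+ m) (r ℕ.+ j) + choose (p ℕ.+ m) (p ℕ.+ j)
      ≈⟨ +-cong (below j) (choose-p+-high m j) ⟩
    choose m (r ℕ.+ j) + prev j + (choose m (p ℕ.+ j) + choose m j)
      ≡⟨ rearrange (choose m (r ℕ.+ j)) (prev j) (choose m (p ℕ.+ j)) (choose m j) ⟩
    (choose m (r ℕ.+ j) + choose m (p ℕ.+ j)) + (prev j + choose m j)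
      ≡⟨ cong₂ _+_ (trans (cong (λ q → choose m (r ℕ.+ j) + choose m q) p+j≡) (trans (sym (pascal m (r ℕ.+ j))) (cong (choose (suc m)) (sym p+j≡)))) (prev-pascal j) ⟩
    choose (suc m) (p ℕ.+ j) + choose (suc m) j                ∎
    where
    open ≈-Reasoning
    r : ℕ
    r = ℕ.pred p
    p+j≡ : p ℕ.+ j ≡ suc (r ℕ.+ j)
    p+j≡ = cong (ℕ._+ j) (sym (ℕP.suc-pred p))
    -- C(m, j-1), with value 0 at j = 0.
    prev : ℕ → ℤ
    prev zero    = + 0
    prev (suc j) = choose m j
    prev-pascal : ∀ j → prev j + choose m j ≡ choose (suc m) j
    prev-pascal zero    = refl
    prev-pascal (suc j) = sym (pascal m j)
    -- Pascal's rule needs the entry at p + j - 1, which falls into the low range exactly for j = 0.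
    below : ∀ j → choose (p ℕ.+ m) (r ℕ.+ j) ≈ choose m (r ℕ.+ j) + prev j
    below zero = ≈-trans (choose-p+-low m (r ℕ.+ 0) (subst (ℕ._< p) (sym (ℕP.+-identityʳ r)) (ℕP.≤-reflexive (ℕP.suc-pred p))))
                         (≈-reflexive (sym (ℤP.+-identityʳ (choose m (r ℕ.+ 0)))))
    below (suc j) = subst (λ q → choose (p ℕ.+ m) q ≈ choose m q + choose m j)
                      (trans (cong (ℕ._+ j) (sym (ℕP.suc-pred p))) (sym (ℕP.+-suc r j))) (choose-p+-high m j)
    rearrange : ∀ a b c d → a + b + (c + d) ≡ (a + c) + (b + d)
    rearrange = solve-∀

-- Monic integer polynomials and division by linear factors.

module MonicPolynomials where
  open Int using (_+_; _*_; _-_; -_)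

  -- z ↦ z^d + c_{d-1} z^{d-1} + ... + c₀ for the vector c₀ ∷ ... ∷ c_{d-1}.
  eval : ∀ {d} → Vec ℤ d → ℤ → ℤ
  eval []       z = + 1
  eval (c ∷ cs) z = z * eval cs z + c

  -- The polynomial u + a v, still monic because v has the smaller degree.
  addMul : ∀ {d} → Vec ℤ (suc d) → ℤ → Vec ℤ d → Vec ℤ (suc d)
  addMul (c ∷ cs) a []       = c + a ∷ cs
  addMul (c ∷ cs) a (e ∷ es) = c + a * e ∷ addMul cs a es

  eval-addMul : ∀ {d} (u : Vec ℤ (suc d)) a (v : Vec ℤ d) z → eval (addMul u a v) z ≡ eval u z + a * eval v z
  eval-addMul (c ∷ cs) a []       z = identity (z * eval cs z) a c
    where
    identity : ∀ x a c → x + (c + a) ≡ x + c + a * + 1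
    identity = solve-∀
  eval-addMul (c ∷ cs) a (e ∷ es) z =
    trans (cong (λ u → z * u + (c + a * e)) (eval-addMul cs a es z)) (identity z a c e (eval cs z) (eval es z))
    where
    identity : ∀ z a c e x y → z * (x + a * y) + (c + a * e) ≡ z * x + c + a * (z * y + e)
    identity = solve-∀

  -- Synthetic division: the polynomial (v(z) - v(a)) / (z - a).
  quotient : ∀ {d} → Vec ℤ (suc d) → ℤ → Vec ℤ d
  quotient (c ∷ [])      a = []
  quotient (c ∷ e ∷ es)  a = addMul (e ∷ es) a (quotient (e ∷ es) a)

  eval-quotient : ∀ {d} (v : Vec ℤ (suc d)) a z → eval v z - eval v a ≡ (z - a) * eval (quotient v a) z
  eval-quotient (c ∷ []) a z = identity z a c
    where
    identity : ∀ z a c → z * + 1 + c - (a * + 1 + c) ≡ (z - a) * + 1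
    identity = solve-∀
  eval-quotient (c ∷ v@(_ ∷ _)) a z = begin
    z * eval v z + c - (a * eval v a + c)              ≡⟨ split z a c (eval v z) (eval v a) ⟩
    (z - a) * eval v z + a * (eval v z - eval v a)     ≡⟨ cong (λ u → (z - a) * eval v z + a * u) (eval-quotient v a z) ⟩
    (z - a) * eval v z + a * ((z - a) * eval (quotient v a) z)
                                                       ≡⟨ factor z a (eval v z) (eval (quotient v a) z) ⟩
    (z - a) * (eval v z + a * eval (quotient v a) z)   ≡⟨ cong ((z - a) *_) (eval-addMul v a (quotient v a) z) ⟨
    (z - a) * eval (addMul v a (quotient v a)) z       ∎
    where
    open ≡-Reasoning
    split : ∀ z a c x y → z * x + c - (a * y + c) ≡ (z - a) * x + a * (x - y)
    split = solve-∀
    factor : ∀ z a x y → (z - a) * x + a * ((z - a) * y) ≡ (z - a) * (x + a * y)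
    factor = solve-∀

  -- The quotient (z^(2k+2) - d^(k+1)) / (z² - d), used to count square roots of d modulo p.
  geometric : ℤ → ∀ k → Vec ℤ (k ℕ.+ k)
  geometric d zero    = []
  geometric d (suc k) = subst (Vec ℤ) (sym (cong suc (ℕP.+-suc k k))) (d Int.^ suc k ∷ + 0 ∷ geometric d k)

  eval-geometric : ∀ d k z → (z * z - d) * eval (geometric d k) z ≡ (z * z) Int.^ suc k - d Int.^ suc k
  eval-geometric d zero    z = identity z d
    where
    identity : ∀ z d → (z * z - d) * + 1 ≡ z * z * + 1 - d * + 1
    identity = solve-∀
  eval-geometric d (suc k) z = begin
    (z * z - d) * eval (geometric d (suc k)) z
      ≡⟨ cong ((z * z - d) *_) (eval-subst (sym (cong suc (ℕP.+-suc k k))) (d Int.^ suc k ∷ + 0 ∷ geometric d k)) ⟩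
    (z * z - d) * (z * (z * eval (geometric d k) z + + 0) + d Int.^ suc k)
      ≡⟨ split z d (eval (geometric d k) z) (d Int.^ suc k) ⟩
    z * z * ((z * z - d) * eval (geometric d k) z) + (z * z - d) * d Int.^ suc k
      ≡⟨ cong (λ u → z * z * u + (z * z - d) * d Int.^ suc k) (eval-geometric d k z) ⟩
    z * z * ((z * z) Int.^ suc k - d Int.^ suc k) + (z * z - d) * d Int.^ suc k
      ≡⟨ cancel (z * z) d ((z * z) Int.^ suc k) (d Int.^ suc k) ⟩
    z * z * (z * z) Int.^ suc k - d * d Int.^ suc k ∎
    where
    open ≡-Reasoning
    eval-subst : ∀ {i j} (eq : i ≡ j) (v : Vec ℤ i) → eval (subst (Vec ℤ) eq v) z ≡ eval v z
    eval-subst refl v = refl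
    split : ∀ z d x u → (z * z - d) * (z * (z * x + + 0) + u) ≡ z * z * ((z * z - d) * x) + (z * z - d) * u
    split = solve-∀
    cancel : ∀ s d x u → s * (x - u) + (s - d) * u ≡ s * x - d * u
    cancel = solve-∀

open MonicPolynomials

module PowerLaws where
  open Int using (_*_; _^_)

  ^-distribʳ-* : ∀ a b n → (a * b) ^ n ≡ a ^ n * b ^ n
  ^-distribʳ-* a b zero    = refl
  ^-distribʳ-* a b (suc n) = trans (cong (a * b *_) (^-distribʳ-* a b n)) (interchange a b (a ^ n) (b ^ n))
    where
    interchange : ∀ a b c d → a * b * (c * d) ≡ a * c * (b * d)
    interchange = solve-∀

  square-^ : ∀ a n → (a * a) ^ n ≡ a ^ (n ℕ.+ n)
  square-^ a n = trans (^-distribʳ-* a a n) (sym (ℤP.^-distribˡ-+-* a n n))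

open PowerLaws

-- Odd prime modulus: Euler's criterion and linear recurrences, with m = (p-1)/2.

module OddPrimeCongruence (p : ℕ) (p-prime : Prime p) (m : ℕ) (0<m : 0 ℕ.< m) (p≡1+2m : p ≡ suc (m ℕ.+ m)) where
  open Int using (_+_; _*_; _-_; -_; _^_)
  open PrimeCongruence p p-prime public

  2m<p : m ℕ.+ m ℕ.< p
  2m<p = ℕP.≤-reflexive (sym p≡1+2m)

  fermat′ : ∀ a → ¬ a ≈ + 0 → a ^ (m ℕ.+ m) ≈ + 1
  fermat′ a a≉0 = *-cancelˡ a (a ^ (m ℕ.+ m)) (+ 1) a≉0
    (≈-trans (subst (λ q → a ^ q ≈ a) p≡1+2m (fermat a)) (≈-reflexive (sym (ℤP.*-identityʳ a))))

  inverse : ∀ a → ¬ a ≈ + 0 → ∃ λ b → a * b ≈ + 1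
  inverse a a≉0 = a ^ ℕ.pred (m ℕ.+ m) ,
    subst (λ q → a ^ q ≈ + 1) (sym (ℕP.suc-pred (m ℕ.+ m) {{ℕ.>-nonZero (ℕP.<-≤-trans 0<m (ℕP.m≤m+n m m))}})) (fermat′ a a≉0)

  *-cancel-≈0 : ∀ c a → ¬ c ≈ + 0 → c * a ≈ + 0 → a ≈ + 0
  *-cancel-≈0 c a c≉0 h = [ (λ c≈0 → ⊥-elim (c≉0 c≈0)) , (λ a≈0 → a≈0) ]′ (*≈0 c a h)

  -- Lagrange's bound on the number of roots. The roots are taken consecutive: splitting off the
  -- smallest leaves an interval again, and differences lie strictly between 0 and p, hence are
  -- invertible.
  too-many-roots : ∀ d (v : Vec ℤ d) j → j ℕ.+ d ℕ.< p →
    (∀ i → j ℕ.≤ i → i ℕ.≤ j ℕ.+ d → eval v (+ i) ≈ + 0) → ⊥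
  -- A monic polynomial of degree 0 is the constant 1.
  too-many-roots zero [] j _ roots = +n≉0 {1} (s≤s z≤n) 1<p (roots j ℕP.≤-refl (ℕP.m≤m+n j 0))
  too-many-roots (suc d) v j j+d<p roots =
    too-many-roots d (quotient v (+ j)) (suc j) (subst (ℕ._< p) (ℕP.+-suc j d) j+d<p) roots′
    where
    roots′ : ∀ i → suc j ℕ.≤ i → i ℕ.≤ suc j ℕ.+ d → eval (quotient v (+ j)) (+ i) ≈ + 0
    roots′ i j<i i≤1+j+d = *-cancel-≈0 (+ i - + j) (eval (quotient v (+ j)) (+ i)) i-j≉0
      (≈-trans (≈-reflexive (sym (eval-quotient v (+ j) (+ i))))
        (minus-cong (roots i (ℕP.<⇒≤ j<i) i≤j+1+d) (roots j ℕP.≤-refl (ℕP.m≤m+n j (suc d)))))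
      where
      i≤j+1+d : i ℕ.≤ j ℕ.+ suc d
      i≤j+1+d = subst (i ℕ.≤_) (sym (ℕP.+-suc j d)) i≤1+j+d
      i-j≉0 : ¬ + i - + j ≈ + 0
      i-j≉0 h = +n≉0 (ℕP.m<n⇒0<n∸m j<i) (ℕP.≤-<-trans (ℕP.m∸n≤m i j) (ℕP.≤-<-trans i≤j+1+d j+d<p))
        (subst (_≈ + 0) (trans (ℤP.m-n≡m⊖n i j) (ℤP.⊖-≥ (ℕP.<⇒≤ j<i))) h)

  IsSquare : ℤ → Set
  IsSquare a = ∃ λ x → x ℕ.< p × + x * + x ≈ a

  euler-square : ∀ a → ¬ a ≈ + 0 → IsSquare a → a ^ m ≈ + 1
  euler-square a a≉0 (x , _ , x²≈a) = begin
    a ^ m                ≈⟨ ^-cong m x²≈a ⟨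
    (+ x * + x) ^ m      ≡⟨ square-^ (+ x) m ⟩
    (+ x) ^ (m ℕ.+ m)    ≈⟨ fermat′ (+ x) (λ x≈0 → a≉0 (≈-trans (≈-sym x²≈a) (≈-trans (*-congʳ (+ x) x≈0) (≈-reflexive (ℤP.*-zeroˡ (+ x)))))) ⟩
    + 1                  ∎
    where open ≈-Reasoning

  -- If a were a non-square with a^m = 1, then (z^2m - a^m)/(z² - a), which has
  -- degree p - 3, would vanish at all z ≠ 0.
  euler-nonsquare : ∀ a → ¬ a ≈ + 0 → ¬ IsSquare a → a ^ m ≈ - + 1
  -- From (a^m - 1)(a^m + 1) = a^(p-1) - 1 ≡ 0 only a^m ≡ 1 has to be excluded.
  euler-nonsquare a a≉0 ¬sq = [ (λ h → ⊥-elim (a^m≉1 (-≈0⇒≈ h))) , (λ h → -≈0⇒≈ h) ]′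
    (*≈0 (a ^ m - + 1) (a ^ m - - + 1) (by ((+ 1) ⊙ (subst (_≈ + 1) (ℤP.^-distribˡ-+-* a m m) (fermat′ a a≉0))) (identity (a ^ m))))
    where
    identity : ∀ u → (u - + 1) * (u - - + 1) - + 0 ≡ + 1 * (u * u - + 1)
    identity = solve-∀
    k : ℕ
    k = ℕ.pred m
    1+k≡m : suc k ≡ m
    1+k≡m = ℕP.suc-pred m {{ℕ.>-nonZero 0<m}}
    2k<2m : suc (k ℕ.+ k) ℕ.< m ℕ.+ m
    2k<2m = subst (λ q → suc (k ℕ.+ k) ℕ.< q ℕ.+ q) 1+k≡m (s≤s (ℕP.≤-reflexive (sym (ℕP.+-suc k k))))
    a^m≉1 : ¬ a ^ m ≈ + 1
    -- The degree is 2k = p - 3, and the points 1, ..., p - 2 are one too many.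
    a^m≉1 a^m≈1 = too-many-roots (k ℕ.+ k) (geometric a k) 1 (ℕP.<-trans 2k<2m 2m<p) roots
      where
      roots : ∀ i → 1 ℕ.≤ i → i ℕ.≤ suc (k ℕ.+ k) → eval (geometric a k) (+ i) ≈ + 0
      roots i 0<i i≤ = *-cancel-≈0 (+ i * + i - a) (eval (geometric a k) (+ i))
        (λ h → ¬sq (i , i<p , -≈0⇒≈ h)) (begin
          (+ i * + i - a) * eval (geometric a k) (+ i)    ≡⟨ eval-geometric a k (+ i) ⟩
          (+ i * + i) ^ suc k - a ^ suc k                 ≡⟨ cong (λ q → (+ i * + i) ^ q - a ^ q) 1+k≡m ⟩
          (+ i * + i) ^ m - a ^ m                         ≡⟨ cong (_- a ^ m) (square-^ (+ i) m) ⟩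
          (+ i) ^ (m ℕ.+ m) - a ^ m                       ≈⟨ minus-cong (fermat′ (+ i) (+n≉0 0<i i<p)) a^m≈1 ⟩
          + 0                                             ∎)
        where
        open ≈-Reasoning
        i<p : i ℕ.< p
        i<p = ℕP.≤-<-trans i≤ (ℕP.<-trans 2k<2m 2m<p)

  0^m≈0 : ∀ a → a ≈ + 0 → a ^ m ≈ + 0
  0^m≈0 a a≈0 = subst (λ q → a ^ q ≈ + 0) (ℕP.suc-pred m {{ℕ.>-nonZero 0<m}})
    (≈-trans (*-congʳ (a ^ ℕ.pred m) a≈0) (≈-reflexive (ℤP.*-zeroˡ (a ^ ℕ.pred m))))

  isSqModb⇒IsSquare : ∀ a → T (isSqModb p a) → IsSquare a
  isSqModb⇒IsSquare a h with find (any⁻ _ (upTo p) h)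
  ... | x , x∈ , hx = x , ∈-upTo⁻ x∈ , -≈0⇒≈ (∣⇒≈0 (toWitness (subst T (sym (isYes≗does (p ℕD.∣? ∣ + x * + x - a ∣))) hx)))

  IsSquare⇒isSqModb : ∀ a → IsSquare a → T (isSqModb p a)
  IsSquare⇒isSqModb a (x , x<p , h) = any⁺ _ (lose (∈-upTo⁺ x<p) (subst T (isYes≗does (p ℕD.∣? ∣ + x * + x - a ∣)) (fromWitness (≈0⇒∣ (≈⇒-≈0 h)))))

  legendreℤ≈^ : ∀ a → legendreℤ p a ≈ a ^ m
  legendreℤ≈^ a with p ℕD.∣? ∣ a ∣
  ... | yes p∣a = ≈-sym (0^m≈0 a (∣⇒≈0 p∣a))
  -- Abstracting both implications along with the Boolean specialises them: for `true` the first one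
  -- produces a square root, for `false` the second one refutes every root.
  ... | no  p∤a with isSqModb p a | isSqModb⇒IsSquare a | IsSquare⇒isSqModb a
  ...   | true  | sq | _  = ≈-sym (euler-square a (λ h → p∤a (≈0⇒∣ h)) (sq _))
  ...   | false | _  | sq = ≈-sym (euler-nonsquare a (λ h → p∤a (≈0⇒∣ h)) sq)

  module _ (a b c : ℤ) (D : ℤ) (D≡ : D ≡ b * b - + 4 * a * c) where

    -- With Δ = 2a E - b for the shift E, the recurrence says Δ² = D, and so
    -- 2a E = (2a E)^p = (b + Δ)^p = b + D^m Δ.
    lucas : (s : ℕ → ℤ) → (∀ n → suc (suc n) ℕ.≤ p → a * s (suc (suc n)) ≈ b * s (suc n) - c * s n) →
      + 2 * a * s p ≈ b * s 0 + D ^ m * (+ 2 * a * s 1 - b * s 0)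
    lucas s rec = begin
      + 2 * a * s p                   ≈⟨ *-congʳ (s p) (fermat (+ 2 * a)) ⟨
      (+ 2 * a) ^ p * s p             ≈⟨ proj₁ (closed p ℕP.≤-refl) ⟩
      shiftPow b p e 0                ≈⟨ shiftPow-p b e ⟩
      b ^ p * s 0 + e p               ≈⟨ +-cong (*-congʳ (s 0) (fermat b)) (≈-reflexive (trans (cong e p≡1+2m) (e-odd m))) ⟩
      b * s 0 + D ^ m * (+ 2 * a * s 1 - b * s 0) ∎
      where
      open ≈-Reasoning
      -- `e n` is Δ^n s at index 0: two initial values, then Δ² = D.
      e : ℕ → ℤ
      e zero          = s 0
      e (suc zero)    = + 2 * a * s 1 - b * s 0
      e (suc (suc n)) = D * e n
      e-odd : ∀ n → e (suc (n ℕ.+ n)) ≡ D ^ n * (+ 2 * a * s 1 - b * s 0)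
      e-odd zero    = sym (ℤP.*-identityˡ (+ 2 * a * s 1 - b * s 0))
      e-odd (suc n) = trans (cong (λ q → e (suc (suc q))) (ℕP.+-suc n n))
        (trans (cong (D *_) (e-odd n)) (sym (ℤP.*-assoc D (D ^ n) (+ 2 * a * s 1 - b * s 0))))
      -- The order of the recurrence is two, hence the pair; the bounds are there because the
      -- recurrence is only assumed up to index p.
      closed : ∀ n → n ℕ.≤ p → ((+ 2 * a) ^ n * s n ≈ shiftPow b n e 0)
             × (suc n ℕ.≤ p → (+ 2 * a) ^ suc n * s (suc n) ≈ shiftPow b (suc n) e 0)
      closed zero n≤p = ≈-reflexive (ℤP.*-identityˡ (s 0)) , λ _ → ≈-reflexive (first a b (s 0) (s 1))
        where
        first : ∀ a b x y → + 2 * a * + 1 * y ≡ b * x + (+ 2 * a * y - b * x)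
        first = solve-∀
      closed (suc n) n<p with closed n (ℕP.<⇒≤ n<p)
      ... | h₀ , h₁ = h₁ n<p , λ 2+n≤p → ≈-trans
        (by ((+ 4 * a * (+ 2 * a) ^ n) ⊙ (rec n 2+n≤p) ⊞ (+ 2 * b) ⊙ (h₁ n<p) ⊞ (D - b * b) ⊙ h₀)
          -- `D` is expanded to b² - 4ac for the ring identity and folded again afterwards.
          (trans (cong (λ D → + 2 * a * (+ 2 * a * (+ 2 * a) ^ n) * s (suc (suc n)) - (+ 2 * b * shiftPow b (suc n) e 0 + (D - b * b) * shiftPow b n e 0)) D≡)
          (trans (step a b c ((+ 2 * a) ^ n) (s (suc (suc n))) (s (suc n)) (s n) (shiftPow b (suc n) e 0) (shiftPow b n e 0))
          (cong (λ D → + 4 * a * (+ 2 * a) ^ n * (a * s (suc (suc n)) - (b * s (suc n) - c * s n)) + + 2 * b * (+ 2 * a * (+ 2 * a) ^ n * s (suc n) - shiftPow b (suc n) e 0) + (D - b * b) * ((+ 2 * a) ^ n * s n - shiftPow b n e 0)) (sym D≡)))))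
        (≈-reflexive (sym (shiftPow-quadratic b D n e 0 (λ _ → refl))))
        where
        step : ∀ a b c u s₂ s₁ s₀ v₁ v₀ →
          + 2 * a * (+ 2 * a * u) * s₂ - (+ 2 * b * v₁ + (b * b - + 4 * a * c - b * b) * v₀)
          ≡ + 4 * a * u * (a * s₂ - (b * s₁ - c * s₀)) + + 2 * b * (+ 2 * a * u * s₁ - v₁)
            + (b * b - + 4 * a * c - b * b) * (u * s₀ - v₀)
        step = solve-∀

    -- The sequence is continued one step to the left (up to the factor c).
    lucas-pred : (s : ℕ → ℤ) → (∀ n → suc (suc n) ℕ.≤ p → a * s (suc (suc n)) ≈ b * s (suc n) - c * s n) →
      + 2 * a * (c * s (ℕ.pred p)) ≈ b * (b * s 0 - a * s 1) + D ^ m * (+ 2 * a * (c * s 0) - b * (b * s 0 - a * s 1))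
    lucas-pred s rec = subst (λ q → + 2 * a * q ≈ b * (b * s 0 - a * s 1) + D ^ m * (+ 2 * a * (c * s 0) - b * (b * s 0 - a * s 1)))
      (trans (cong s′ p≡1+2m) (cong (λ q → c * s (ℕ.pred q)) (sym p≡1+2m))) (lucas s′ rec′)
      where
      s′ : ℕ → ℤ
      -- Solves a s(1) = b s(0) - c s(-1) for c s(-1), which avoids dividing by c.
      s′ zero    = b * s 0 - a * s 1
      s′ (suc n) = c * s n
      rec′ : ∀ n → suc (suc n) ℕ.≤ p → a * s′ (suc (suc n)) ≈ b * s′ (suc n) - c * s′ n
      rec′ zero    _ = ≈-reflexive (identity a b c (s 0) (s 1))
        where
        identity : ∀ a b c x y → a * (c * y) ≡ b * (c * x) - c * (b * x - a * y)
        identity = solve-∀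
      rec′ (suc n) h = by (c ⊙ (rec n (ℕP.<⇒≤ h))) (identity a b c (s n) (s (suc n)) (s (suc (suc n))))
        where
        identity : ∀ a b c x y z → a * (c * z) - (b * (c * y) - c * (c * x)) ≡ c * (a * z - (b * y - c * x))
        identity = solve-∀

  -- After p - 1 steps the ratio v / u has been raised to the power p - 1, which is 1 by Fermat's
  -- theorem.
  geometric-periodic : ∀ u v (s : ℕ → ℤ) → ¬ u ≈ + 0 → ¬ v ≈ + 0 →
    (∀ n → n ℕ.< m ℕ.+ m → u * s (suc n) ≈ v * s n) → s (m ℕ.+ m) ≈ s 0
  geometric-periodic u v s u≉0 v≉0 rec = begin
    s (m ℕ.+ m)                     ≡⟨ ℤP.*-identityˡ (s (m ℕ.+ m)) ⟨
    + 1 * s (m ℕ.+ m)               ≈⟨ *-congʳ (s (m ℕ.+ m)) (fermat′ u u≉0) ⟨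
    u ^ (m ℕ.+ m) * s (m ℕ.+ m)     ≈⟨ closed (m ℕ.+ m) ℕP.≤-refl ⟩
    v ^ (m ℕ.+ m) * s 0             ≈⟨ *-congʳ (s 0) (fermat′ v v≉0) ⟩
    + 1 * s 0                       ≡⟨ ℤP.*-identityˡ (s 0) ⟩
    s 0                             ∎
    where
    open ≈-Reasoning
    closed : ∀ n → n ℕ.≤ m ℕ.+ m → u ^ n * s n ≈ v ^ n * s 0
    closed zero    _   = ≈-refl
    closed (suc n) n<  = by ((u ^ n) ⊙ (rec n n<) ⊞ v ⊙ (closed n (ℕP.<⇒≤ n<)))
      (step u v (u ^ n) (v ^ n) (s 0) (s n) (s (suc n)))
      where
      step : ∀ u v x y s₀ s s′ → u * x * s′ - v * y * s₀ ≡ x * (u * s′ - v * s) + v * (x * s - y * s₀)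
      step = solve-∀

-- The coefficients of F and the telescoping recurrence.

module ShiftedBinomials where
  open Int using (_+_; _*_; _-_; -_; _^_)

  -- The coefficients of y^w times the generating function of f. Filling with zeros lets Pascal's
  -- rule hold across the boundary w as well.
  shifted : ℕ → (ℕ → ℤ) → ℕ → ℤ
  shifted zero    f i       = f i
  shifted (suc w) f zero    = + 0
  shifted (suc w) f (suc i) = shifted w f i

  shifted-at : ∀ w f i → shifted w f (w ℕ.+ i) ≡ f i
  shifted-at zero    f i = refl
  shifted-at (suc w) f i = shifted-at w f i

  shifted-below : ∀ w f i → i ℕ.< w → shifted w f i ≡ + 0
  shifted-below (suc w) f zero    _         = refl
  shifted-below (suc w) f (suc i) (s≤s i<w) = shifted-below w f i i<w

  shifted-above : ∀ w f i → w ℕ.< i → (∀ j → f (suc j) ≡ + 0) → shifted w f i ≡ + 0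
  shifted-above zero    f (suc i) _         f≡0 = f≡0 i
  shifted-above (suc w) f (suc i) (s≤s w<i) f≡0 = shifted-above w f i w<i f≡0

  shifted-pascal : ∀ w n i →
    shifted w (choose (suc n)) (suc i) ≡ shifted w (choose n) i + shifted w (choose n) (suc i)
  shifted-pascal zero          n i       = pascal n i
  shifted-pascal (suc zero)    n zero    = refl
  shifted-pascal (suc (suc w)) n zero    = refl
  shifted-pascal (suc w)       n (suc i) = shifted-pascal w n i

  shifted-pascal³ : ∀ w n i → let β = shifted w (choose n) in
    shifted w (choose (3 ℕ.+ n)) (3 ℕ.+ i) ≡ β i + + 3 * β (1 ℕ.+ i) + + 3 * β (2 ℕ.+ i) + β (3 ℕ.+ i)
  shifted-pascal³ w n i = begin
    B 3 3                                             ≡⟨ shifted-pascal w (2 ℕ.+ n) (2 ℕ.+ i) ⟩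
    B 2 2 + B 2 3                                     ≡⟨ cong₂ _+_ (shifted-pascal w (1 ℕ.+ n) (1 ℕ.+ i)) (shifted-pascal w (1 ℕ.+ n) (2 ℕ.+ i)) ⟩
    B 1 1 + B 1 2 + (B 1 2 + B 1 3)
      ≡⟨ cong₂ (λ u v → u + v) (cong₂ _+_ (shifted-pascal w n i) (shifted-pascal w n (1 ℕ.+ i)))
           (cong₂ _+_ (shifted-pascal w n (1 ℕ.+ i)) (shifted-pascal w n (2 ℕ.+ i))) ⟩
    B 0 0 + B 0 1 + (B 0 1 + B 0 2) + (B 0 1 + B 0 2 + (B 0 2 + B 0 3))
      ≡⟨ collect (B 0 0) (B 0 1) (B 0 2) (B 0 3) ⟩
    B 0 0 + + 3 * B 0 1 + + 3 * B 0 2 + B 0 3         ∎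
    where
    open ≡-Reasoning
    B : ℕ → ℕ → ℤ
    B u v = shifted w (choose (u ℕ.+ n)) (v ℕ.+ i)
    collect : ∀ a b c d → a + b + (b + c) + (b + c + (c + d)) ≡ a + + 3 * b + + 3 * c + d
    collect = solve-∀

  -- The coefficient of y^i in Σ_{k<N} x^k y^(w-k) (1+y)^(3k).
  coeff : ℤ → ℕ → ℕ → ℕ → ℤ
  coeff x N w i = Σ< N (λ k → x ^ k * shifted w (choose (3 ℕ.* k)) (i ℕ.+ k))

  -- Compares coefficients of y^(i+3) in (x(1+y)³ - y) F: the factor x(1+y)³ / y turns the k-th
  -- summand into the next one, which is `term-suc`.
  coeff-recurrence : ∀ x N w i → let F = coeff x N w in
    x * (F i + + 3 * F (1 ℕ.+ i) + + 3 * F (2 ℕ.+ i) + F (3 ℕ.+ i)) - F (2 ℕ.+ i)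
    ≡ x ^ N * shifted w (choose (3 ℕ.* N)) (2 ℕ.+ i ℕ.+ N) - shifted w (choose 0) (2 ℕ.+ i)
  coeff-recurrence x N w i = begin
    x * (F 0 + + 3 * F 1 + + 3 * F 2 + F 3) - F 2
      ≡⟨ cong (_- F 2) (sym sum-term) ⟩
    Σ< N (λ k → term (suc k)) - Σ< N term
      ≡⟨ Σ<-telescope N term ⟩
    term N - term 0
      ≡⟨ cong (λ u → term N - u) (trans (ℤP.*-identityˡ _) (cong (shifted w (choose 0)) (ℕP.+-identityʳ (2 ℕ.+ i)))) ⟩
    term N - shifted w (choose 0) (2 ℕ.+ i) ∎
    where
    open ≡-Reasoning
    f : ℕ → ℕ → ℤ
    f j k = x ^ k * shifted w (choose (3 ℕ.* k)) (j ℕ.+ i ℕ.+ k)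
    F : ℕ → ℤ
    F j = Σ< N (f j)
    term : ℕ → ℤ
    term = f 2
    β : ℕ → ℕ → ℤ
    β k j = shifted w (choose (3 ℕ.* k)) (j ℕ.+ (i ℕ.+ k))
    term-suc : ∀ k → term (suc k) ≡ x * (f 0 k + + 3 * f 1 k + + 3 * f 2 k + f 3 k)
    term-suc k = trans
      (cong₂ (λ u v → x ^ suc k * shifted w (choose u) (2 ℕ.+ v)) (ℕP.*-suc 3 k) (ℕP.+-suc i k))
      (trans (cong (x ^ suc k *_) (shifted-pascal³ w (3 ℕ.* k) (i ℕ.+ k)))
        (distrib x (x ^ k) (β k 0) (β k 1) (β k 2) (β k 3)))
      where
      distrib : ∀ x u a b c d → x * u * (a + + 3 * b + + 3 * c + d)
              ≡ x * (u * a + + 3 * (u * b) + + 3 * (u * c) + u * d)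
      distrib = solve-∀
    sum-term : Σ< N (λ k → term (suc k)) ≡ x * (F 0 + + 3 * F 1 + + 3 * F 2 + F 3)
    sum-term = begin
      Σ< N (λ k → term (suc k))
        ≡⟨ Σ<-cong N (λ k _ → term-suc k) ⟩
      Σ< N (λ k → x * (f 0 k + + 3 * f 1 k + + 3 * f 2 k + f 3 k))
        ≡⟨ Σ<-* N x (λ k → f 0 k + + 3 * f 1 k + + 3 * f 2 k + f 3 k) ⟩
      x * Σ< N (λ k → f 0 k + + 3 * f 1 k + + 3 * f 2 k + f 3 k)
        ≡⟨ cong (x *_) (trans (Σ<-+ N (λ k → f 0 k + + 3 * f 1 k + + 3 * f 2 k) (f 3))
             (cong (_+ F 3) (trans (Σ<-+ N (λ k → f 0 k + + 3 * f 1 k) (λ k → + 3 * f 2 k))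
               (cong₂ _+_ (trans (Σ<-+ N (f 0) (λ k → + 3 * f 1 k)) (cong (λ u → F 0 + u) (Σ<-* N (+ 3) (f 1))))
                 (Σ<-* N (+ 3) (f 2)))))) ⟩
      x * (F 0 + + 3 * F 1 + + 3 * F 2 + F 3) ∎

open ShiftedBinomials

-- Integrality of the numbers C_k^(2).

module TernaryCatalan where
  open Int using (_+_; _*_; _-_; -_)

  central subcentral catalan : ℕ → ℤ
  central    k       = choose (3 ℕ.* k) k
  subcentral zero    = + 0
  subcentral (suc k) = choose (3 ℕ.* suc k) k
  catalan    k       = central k - + 2 * subcentral k

  -- With K = k + 1, c = C(3K, K) and s = C(3K, K-1), absorption and Pascal's rule give K (s + c) =
  -- (3K + 1) s, that is K c = (2K + 1) s. Hence (2K + 1)(c - 2s) = (2K + 1) c - 2K c = c.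
  catalan-* : ∀ k → catalan (suc k) * + suc (2 ℕ.* suc k) ≡ central (suc k)
  catalan-* k = begin
    (c - + 2 * s) * + suc (2 ℕ.* suc k)                      ≡⟨ cong ((c - + 2 * s) *_) odd ⟩
    (c - + 2 * s) * (+ 2 * K + + 1)                          ≡⟨ expand c s K ⟩
    c + + 2 * (K * (s + c) - (+ 3 * K + + 1) * s)            ≡⟨ cong (λ y → c + + 2 * y) absorbed ⟩
    c + + 0                                                  ≡⟨ ℤP.+-identityʳ c ⟩
    c                                                        ∎
    where
    open ≡-Reasoning
    K c s : ℤ
    K = + suc k
    c = central (suc k)
    s = subcentral (suc k)
    odd : + suc (2 ℕ.* suc k) ≡ + 2 * K + + 1
    odd = trans (cong +_ (ℕP.+-comm 1 (2 ℕ.* suc k))) (trans (ℤP.pos-+ (2 ℕ.* suc k) 1) (cong (_+ + 1) (ℤP.pos-* 2 (suc k))))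
    3K+1 : + suc (3 ℕ.* suc k) ≡ + 3 * K + + 1
    3K+1 = trans (cong +_ (ℕP.+-comm 1 (3 ℕ.* suc k))) (trans (ℤP.pos-+ (3 ℕ.* suc k) 1) (cong (_+ + 1) (ℤP.pos-* 3 (suc k))))
    absorbed : K * (s + c) - (+ 3 * K + + 1) * s ≡ + 0
    absorbed = trans (cong₂ (λ y z → K * y - z * s) (sym (pascal (3 ℕ.* suc k) k)) (sym 3K+1))
      (trans (cong (λ y → y - + suc (3 ℕ.* suc k) * s) (absorption (3 ℕ.* suc k) k)) (ℤP.+-inverseʳ (+ suc (3 ℕ.* suc k) * s)))
    expand : ∀ c s k → (c - + 2 * s) * (+ 2 * k + + 1) ≡ c + + 2 * (k * (s + c) - (+ 3 * k + + 1) * s)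
    expand = solve-∀

open TernaryCatalan

-- The polynomials F, G, H modulo p, for an integer t.

module Evaluation (p : ℕ) (p-prime : Prime p) (p>3 : p > 3) (m : ℕ) (0<m : 0 ℕ.< m) (p≡1+2m : p ≡ suc (m ℕ.+ m)) (t : ℤ) where
  open Int using (_+_; _*_; _-_; -_; _^_)
  open OddPrimeCongruence p p-prime m 0<m p≡1+2m public

  x D E : ℤ
  x = t * t * (t + + 1)
  D = (+ 1 + t) * (+ 1 - + 3 * t)
  E = D ^ m

  0<p : 0 ℕ.< p
  0<p = ℕP.<-trans (s≤s z≤n) 1<p

  -- F (3 + n) is the coefficient of y^n in Σ_{k<p} x^k y^(p-1-k) (1+y)^(3k); the
  -- shift makes the three vanishing coefficients before n = 0 available.  The
  -- same coefficients of the products below are G (1 + n) and H (2 + n).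
  F : ℕ → ℤ
  F = coeff x p (2 ℕ.+ p)

  -- The coefficient of y^n in (x(1+y)³ - y) times the unshifted polynomial, the inhomogeneous term
  -- of both recurrences.
  residual : ℕ → ℤ
  residual n = x * (F n + + 3 * F (1 ℕ.+ n) + + 3 * F (2 ℕ.+ n) + F (3 ℕ.+ n)) - F (2 ℕ.+ n)

  -- The sum p + (p + (p + 0)) is what `3 ℕ.* p` unfolds to, and the form to which the congruences
  -- for C(p + m, j) apply.
  residual≈ : ∀ n → residual n ≈ x * choose (p ℕ.+ (p ℕ.+ (p ℕ.+ 0))) n - shifted p (choose 0) n
  residual≈ n = begin
    residual n
      ≡⟨ coeff-recurrence x p (2 ℕ.+ p) n ⟩
    x ^ p * shifted (2 ℕ.+ p) (choose (3 ℕ.* p)) (2 ℕ.+ n ℕ.+ p) - shifted p (choose 0) n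
      ≡⟨ cong (λ u → x ^ p * u - shifted p (choose 0) n)
           (trans (cong (shifted p (choose (3 ℕ.* p))) (ℕP.+-comm n p)) (shifted-at p (choose (3 ℕ.* p)) n)) ⟩
    x ^ p * choose (3 ℕ.* p) n - shifted p (choose 0) n
      ≈⟨ minus-cong (*-congʳ (choose (3 ℕ.* p) n) (fermat x)) (≈-refl {shifted p (choose 0) n}) ⟩
    x * choose (3 ℕ.* p) n - shifted p (choose 0) n ∎
    where open ≈-Reasoning

  choose-0-suc : ∀ j → choose 0 (suc j) ≡ + 0
  choose-0-suc j = choose-zero {0} {suc j} (s≤s z≤n)

  choose-3p-low : ∀ n → n ℕ.< p → choose (p ℕ.+ (p ℕ.+ (p ℕ.+ 0))) n ≈ choose 0 n
  choose-3p-low n n<p = ≈-trans (choose-p+-low _ n n<p) (≈-trans (choose-p+-low _ n n<p) (choose-p+-low 0 n n<p))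

  -- The coefficient of y^(p+n) in (1 + y^p)³; `choose 0 n` acts as the indicator of n = 0.
  choose-3p-high : ∀ n → n ℕ.< p → choose (p ℕ.+ (p ℕ.+ (p ℕ.+ 0))) (p ℕ.+ n) ≈ + 3 * choose 0 n
  choose-3p-high n n<p = begin
    choose (p ℕ.+ (p ℕ.+ (p ℕ.+ 0))) (p ℕ.+ n)
      ≈⟨ choose-p+-high _ n ⟩
    choose (p ℕ.+ (p ℕ.+ 0)) (p ℕ.+ n) + choose (p ℕ.+ (p ℕ.+ 0)) n
      ≈⟨ +-cong (choose-p+-high (p ℕ.+ 0) n) (≈-trans (choose-p+-low _ n n<p) (choose-p+-low 0 n n<p)) ⟩
    choose (p ℕ.+ 0) (p ℕ.+ n) + choose (p ℕ.+ 0) n + choose 0 n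
      ≈⟨ +-congʳ (choose 0 n) (+-cong (choose-p+-high 0 n) (choose-p+-low 0 n n<p)) ⟩
    choose 0 (p ℕ.+ n) + choose 0 n + choose 0 n + choose 0 n
      ≡⟨ cong (λ u → u + choose 0 n + choose 0 n + choose 0 n) (choose-zero {0} {p ℕ.+ n} (ℕP.<-≤-trans 0<p (ℕP.m≤m+n p n))) ⟩
    + 0 + choose 0 n + choose 0 n + choose 0 n
      ≡⟨ triple (choose 0 n) ⟩
    + 3 * choose 0 n ∎
    where
    open ≈-Reasoning
    triple : ∀ a → + 0 + a + a + a ≡ + 3 * a
    triple = solve-∀

  residual-0 : residual 0 ≈ x
  residual-0 = begin
    residual 0       ≈⟨ residual≈ 0 ⟩
    x * + 1 - shifted p (choose 0) 0  ≡⟨ cong (λ u → x * + 1 - u) (shifted-below p (choose 0) 0 0<p) ⟩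
    x * + 1 - + 0    ≡⟨ simplify x ⟩
    x                ∎
    where
    open ≈-Reasoning
    simplify : ∀ x → x * + 1 - + 0 ≡ x
    simplify = solve-∀

  residual-low : ∀ n → suc n ℕ.< p → residual (suc n) ≈ + 0
  residual-low n n<p = begin
    residual (suc n)     ≈⟨ residual≈ (suc n) ⟩
    x * choose (p ℕ.+ (p ℕ.+ (p ℕ.+ 0))) (suc n) - shifted p (choose 0) (suc n)
      ≈⟨ minus-cong (*-congˡ x (choose-3p-low (suc n) n<p)) (≈-reflexive (shifted-below p (choose 0) (suc n) n<p)) ⟩
    x * choose 0 (suc n) - + 0  ≡⟨ cong (λ u → x * u - + 0) (choose-0-suc n) ⟩
    x * + 0 - + 0        ≡⟨ simplify x ⟩
    + 0                  ∎
    where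
    open ≈-Reasoning
    simplify : ∀ x → x * + 0 - + 0 ≡ + 0
    simplify = solve-∀

  residual-p : residual p ≈ + 3 * x - + 1
  residual-p = begin
    residual p      ≈⟨ residual≈ p ⟩
    x * choose (p ℕ.+ (p ℕ.+ (p ℕ.+ 0))) p - shifted p (choose 0) p
      ≡⟨ cong (λ q → x * choose (p ℕ.+ (p ℕ.+ (p ℕ.+ 0))) q - shifted p (choose 0) q) (sym (ℕP.+-identityʳ p)) ⟩
    x * choose (p ℕ.+ (p ℕ.+ (p ℕ.+ 0))) (p ℕ.+ 0) - shifted p (choose 0) (p ℕ.+ 0)
      ≈⟨ minus-cong (*-congˡ x (choose-3p-high 0 0<p)) (≈-reflexive (shifted-at p (choose 0) 0)) ⟩
    x * + 3 - + 1   ≡⟨ cong (_- + 1) (ℤP.*-comm x (+ 3)) ⟩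
    + 3 * x - + 1   ∎
    where open ≈-Reasoning

  residual-high : ∀ n → suc n ℕ.< p → residual (p ℕ.+ suc n) ≈ + 0
  residual-high n n<p = begin
    residual (p ℕ.+ suc n)     ≈⟨ residual≈ (p ℕ.+ suc n) ⟩
    x * choose (p ℕ.+ (p ℕ.+ (p ℕ.+ 0))) (p ℕ.+ suc n) - shifted p (choose 0) (p ℕ.+ suc n)
      ≈⟨ minus-cong (*-congˡ x (choose-3p-high (suc n) n<p))
           (≈-reflexive (shifted-above p (choose 0) (p ℕ.+ suc n) (ℕP.m<m+n p (s≤s z≤n)) choose-0-suc)) ⟩
    x * (+ 3 * choose 0 (suc n)) - + 0  ≡⟨ cong (λ u → x * (+ 3 * u) - + 0) (choose-0-suc n) ⟩
    x * (+ 3 * + 0) - + 0        ≡⟨ simplify x ⟩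
    + 0                  ∎
    where
    open ≈-Reasoning
    simplify : ∀ x → x * (+ 3 * + 0) - + 0 ≡ + 0
    simplify = solve-∀

  F-below : ∀ i → i ℕ.< 3 → F i ≡ + 0
  F-below i i<3 = trans (Σ<-cong p (λ k k<p → trans
      (cong (x ^ k *_) (shifted-below (2 ℕ.+ p) (choose (3 ℕ.* k)) (i ℕ.+ k) (ℕP.+-mono-≤-< (ℕP.≤-pred i<3) k<p)))
      (ℤP.*-zeroʳ (x ^ k))))
    (Σ<-zero p)

  b₁ : ℤ
  b₁ = (+ 1 - + 2 * t) * (t + + 1)

  c₁ : ℤ
  c₁ = t * (t + + 1)

  G H : ℕ → ℤ
  G j = t * t * F (2 ℕ.+ j) - b₁ * F (1 ℕ.+ j) + c₁ * F j
  H j = (t + + 1) * F (1 ℕ.+ j) + t * F j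

  -- x(1+y)³ - y = ((t+1) + ty)(t² - b₁ y + c₁ y²)
  G-recurrence : ∀ n → (t + + 1) * G (1 ℕ.+ n) + t * G n ≡ residual n
  G-recurrence n = identity t (F n) (F (1 ℕ.+ n)) (F (2 ℕ.+ n)) (F (3 ℕ.+ n))
    where
    identity : ∀ t f₀ f₁ f₂ f₃ → let b = (+ 1 - + 2 * t) * (t + + 1); c = t * (t + + 1) in
      (t + + 1) * (t * t * f₃ - b * f₂ + c * f₁) + t * (t * t * f₂ - b * f₁ + c * f₀)
      ≡ t * t * (t + + 1) * (f₀ + + 3 * f₁ + + 3 * f₂ + f₃) - f₂
    identity = solve-∀

  H-recurrence : ∀ n → t * t * H (2 ℕ.+ n) - b₁ * H (1 ℕ.+ n) + c₁ * H n ≡ residual n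
  H-recurrence n = identity t (F n) (F (1 ℕ.+ n)) (F (2 ℕ.+ n)) (F (3 ℕ.+ n))
    where
    identity : ∀ t f₀ f₁ f₂ f₃ → let b = (+ 1 - + 2 * t) * (t + + 1); c = t * (t + + 1) in
      t * t * ((t + + 1) * f₃ + t * f₂) - b * ((t + + 1) * f₂ + t * f₁) + c * ((t + + 1) * f₁ + t * f₀)
      ≡ t * t * (t + + 1) * (f₀ + + 3 * f₁ + + 3 * f₂ + f₃) - f₂
    identity = solve-∀

  -- The Bezout identity 3t + 2 = t Q - (t + 1)(t y + t - 2) L, read on coefficients.
  F-from-GH : ∀ j → (+ 3 * t + + 2) * F (2 ℕ.+ j) ≡ t * (G j - (t + + 1) * H j) - (t + + 1) * (t - + 2) * H (1 ℕ.+ j)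
  F-from-GH j = identity t (F j) (F (1 ℕ.+ j)) (F (2 ℕ.+ j))
    where
    identity : ∀ t f₀ f₁ f₂ → let b = (+ 1 - + 2 * t) * (t + + 1); c = t * (t + + 1) in
      (+ 3 * t + + 2) * f₂ ≡ t * (t * t * f₂ - b * f₁ + c * f₀ - (t + + 1) * ((t + + 1) * f₁ + t * f₀))
        - (t + + 1) * (t - + 2) * ((t + + 1) * f₂ + t * f₁)
    identity = solve-∀

  -- The identity t (1 - 2y) = (3t + 2) - 2L, read on coefficients.
  W-from-FH : ∀ j → t * (F (2 ℕ.+ j) - + 2 * F (1 ℕ.+ j)) ≡ (+ 3 * t + + 2) * F (2 ℕ.+ j) - + 2 * H (1 ℕ.+ j)
  W-from-FH j = identity t (F (1 ℕ.+ j)) (F (2 ℕ.+ j))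
    where
    identity : ∀ t f₁ f₂ → t * (f₂ - + 2 * f₁) ≡ (+ 3 * t + + 2) * f₂ - + 2 * ((t + + 1) * f₂ + t * f₁)
    identity = solve-∀

  discriminant : D ≡ b₁ * b₁ - + 4 * (t * t) * c₁
  discriminant = identity t
    where
    identity : ∀ t → (+ 1 + t) * (+ 1 - + 3 * t)
      ≡ (+ 1 - + 2 * t) * (t + + 1) * ((+ 1 - + 2 * t) * (t + + 1)) - + 4 * (t * t) * (t * (t + + 1))
    identity = solve-∀

  -- Stands in for E² ≡ 1, which fails when p divides D.
  DE²≈D : D * (E * E) ≈ D
  DE²≈D = begin
    D * (D ^ m * D ^ m)    ≡⟨ cong (D *_) (sym (ℤP.^-distribˡ-+-* D m m)) ⟩
    D ^ suc (m ℕ.+ m)      ≡⟨ cong (D ^_) (sym p≡1+2m) ⟩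
    D ^ p                  ≈⟨ fermat D ⟩
    D                      ∎
    where open ≈-Reasoning

  +2≉0 : ¬ + 2 ≈ + 0
  +2≉0 = +n≉0 (s≤s z≤n) (ℕP.<-trans (s≤s (s≤s (s≤s z≤n))) p>3)

  -- Solving the recurrences of G and H when t and t + 1 are invertible.

  module Generic (t≉0 : ¬ t ≈ + 0) (t+1≉0 : ¬ t + + 1 ≈ + 0) where

    t²≉0 : ¬ t * t ≈ + 0
    t²≉0 = *≉0 t≉0 t≉0

    2t²≉0 : ¬ + 2 * (t * t) ≈ + 0
    2t²≉0 = *≉0 +2≉0 t²≉0

    -t≉0 : ¬ - t ≈ + 0
    -t≉0 h = t≉0 (by (- + 1 ⊙ h) (identity t))
      where
      identity : ∀ t → t - + 0 ≡ - + 1 * (- t - + 0)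
      identity = solve-∀

    H-step : ∀ n → residual n ≈ + 0 → t * t * H (2 ℕ.+ n) ≈ b₁ * H (1 ℕ.+ n) - c₁ * H n
    H-step n h = by (+ 1 ⊙ ≈-trans (≈-reflexive (H-recurrence n)) h)
      (identity (t * t * H (2 ℕ.+ n)) (b₁ * H (1 ℕ.+ n)) (c₁ * H n))
      where
      identity : ∀ a b c → a - (b - c) ≡ + 1 * (a - b + c - + 0)
      identity = solve-∀

    G-step : ∀ n → residual n ≈ + 0 → (t + + 1) * G (1 ℕ.+ n) ≈ - t * G n
    G-step n h = by (+ 1 ⊙ ≈-trans (≈-reflexive (G-recurrence n)) h)
      (identity t ((t + + 1) * G (1 ℕ.+ n)) (G n))
      where
      identity : ∀ t a g → a - - t * g ≡ + 1 * (a + t * g - + 0)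
      identity = solve-∀

    1+n<p : ∀ {n} → n ℕ.< m ℕ.+ m → suc n ℕ.< p
    1+n<p n< = subst (_ ℕ.<_) (sym p≡1+2m) (s≤s n<)

    G-1 : G 1 ≈ t * t
    G-1 = *-cancelˡ (t + + 1) (G 1) (t * t) t+1≉0
      (by (+ 1 ⊙ ≈-trans (≈-reflexive (G-recurrence 0)) residual-0 ⊞ - t ⊙ ≈-reflexive G0≡0) (identity t (G 1) (G 0)))
      where
      G0≡0 : G 0 ≡ + 0
      G0≡0 = trans (cong₂ (λ u v → t * t * u - b₁ * v + c₁ * F 0) (F-below 2 (s≤s (s≤s (s≤s z≤n)))) (F-below 1 (s≤s (s≤s z≤n))))
        (trans (cong (λ u → t * t * + 0 - b₁ * + 0 + c₁ * u) (F-below 0 (s≤s z≤n))) (zeros t b₁ c₁))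
        where
        zeros : ∀ t b c → t * t * + 0 - b * + 0 + c * + 0 ≡ + 0
        zeros = solve-∀
      identity : ∀ t g₁ g₀ → (t + + 1) * g₁ - (t + + 1) * (t * t)
               ≡ + 1 * ((t + + 1) * g₁ + t * g₀ - t * t * (t + + 1)) + - t * (g₀ - + 0)
      identity = solve-∀

    -- The p - 1 steps from index 1 to index p are homogeneous and form one full period; the next
    -- step picks up `residual p`.
    G-p : G p ≈ t * t
    G-p = ≈-trans (≈-reflexive (cong G p≡1+2m)) (≈-trans
      (geometric-periodic (t + + 1) (- t) (λ n → G (1 ℕ.+ n)) t+1≉0 -t≉0
        (λ n n< → G-step (1 ℕ.+ n) (residual-low n (1+n<p n<))))
      G-1)

    G-1+p : G (1 ℕ.+ p) ≈ (t + + 1) * (+ 2 * t - + 1)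
    G-1+p = *-cancelˡ (t + + 1) (G (1 ℕ.+ p)) ((t + + 1) * (+ 2 * t - + 1)) t+1≉0
      (by (+ 1 ⊙ ≈-trans (≈-reflexive (G-recurrence p)) residual-p ⊞ - t ⊙ G-p) (identity t (G (1 ℕ.+ p)) (G p)))
      where
      identity : ∀ t g₁ g₀ → (t + + 1) * g₁ - (t + + 1) * ((t + + 1) * (+ 2 * t - + 1))
        ≡ + 1 * ((t + + 1) * g₁ + t * g₀ - (+ 3 * (t * t * (t + + 1)) - + 1)) + - t * (g₀ - t * t)
      identity = solve-∀

    G-2p : G (p ℕ.+ p) ≈ (t + + 1) * (+ 2 * t - + 1)
    G-2p = ≈-trans (≈-reflexive (cong G (trans (cong (p ℕ.+_) p≡1+2m) (ℕP.+-suc p (m ℕ.+ m))))) (≈-trans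
      (geometric-periodic (t + + 1) (- t) (λ n → G (1 ℕ.+ (p ℕ.+ n))) t+1≉0 -t≉0
        (λ n n< → subst (λ q → (t + + 1) * G (1 ℕ.+ q) ≈ - t * G (1 ℕ.+ (p ℕ.+ n))) (sym (ℕP.+-suc p n))
          (G-step (1 ℕ.+ (p ℕ.+ n)) (subst (λ q → residual q ≈ + 0) (ℕP.+-suc p n) (residual-high n (1+n<p n<))))))
      (≈-trans (≈-reflexive (cong (λ q → G (suc q)) (ℕP.+-identityʳ p))) G-1+p))

    H-1 : H 1 ≡ + 0
    H-1 = trans (cong₂ (λ u v → (t + + 1) * u + t * v) (F-below 2 (s≤s (s≤s (s≤s z≤n)))) (F-below 1 (s≤s (s≤s z≤n)))) (zeros t)
      where
      zeros : ∀ t → (t + + 1) * + 0 + t * + 0 ≡ + 0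
      zeros = solve-∀

    H-0 : H 0 ≡ + 0
    H-0 = trans (cong₂ (λ u v → (t + + 1) * u + t * v) (F-below 1 (s≤s (s≤s z≤n))) (F-below 0 (s≤s z≤n))) (zeros t)
      where
      zeros : ∀ t → (t + + 1) * + 0 + t * + 0 ≡ + 0
      zeros = solve-∀

    H-2 : H 2 ≈ t + + 1
    H-2 = *-cancelˡ (t * t) (H 2) (t + + 1) t²≉0
      (by (+ 1 ⊙ ≈-trans (≈-reflexive (H-recurrence 0)) residual-0 ⊞ b₁ ⊙ ≈-reflexive H-1 ⊞ - c₁ ⊙ ≈-reflexive H-0)
        (identity t b₁ c₁ (H 2) (H 1) (H 0)))
      where
      identity : ∀ t b c h₂ h₁ h₀ → t * t * h₂ - t * t * (t + + 1)
        ≡ + 1 * (t * t * h₂ - b * h₁ + c * h₀ - t * t * (t + + 1)) + b * (h₁ - + 0) + - c * (h₀ - + 0)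
      identity = solve-∀

    block₁ : ∀ n → 2 ℕ.+ n ℕ.≤ p → t * t * H (3 ℕ.+ n) ≈ b₁ * H (2 ℕ.+ n) - c₁ * H (1 ℕ.+ n)
    block₁ n n≤ = H-step (1 ℕ.+ n) (residual-low n n≤)

    -- `lucas` for the block that starts with the values 0 and t + 1 at indices 1 and 2.
    H-1+p : H (1 ℕ.+ p) ≈ E * (t + + 1)
    H-1+p = *-cancelˡ (+ 2 * (t * t)) (H (1 ℕ.+ p)) (E * (t + + 1)) 2t²≉0
      (by (+ 1 ⊙ lucas (t * t) b₁ c₁ D discriminant (λ n → H (1 ℕ.+ n)) block₁
           ⊞ (+ 2 * (t * t) * E) ⊙ H-2 ⊞ (b₁ - E * b₁) ⊙ ≈-reflexive H-1)
        (identity t b₁ E (H (1 ℕ.+ p)) (H 2) (H 1)))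
      where
      identity : ∀ t b e h h₂ h₁ → + 2 * (t * t) * h - + 2 * (t * t) * (e * (t + + 1))
        ≡ + 1 * (+ 2 * (t * t) * h - (b * h₁ + e * (+ 2 * (t * t) * h₂ - b * h₁)))
        + + 2 * (t * t) * e * (h₂ - (t + + 1)) + (b - e * b) * (h₁ - + 0)
      identity = solve-∀

    2tH-p : + 2 * t * H p ≈ (E - + 1) * b₁
    2tH-p = *-cancelˡ (t * t * (t + + 1)) (+ 2 * t * H p) ((E - + 1) * b₁) (*≉0 t²≉0 t+1≉0)
      (by (+ 1 ⊙ subst (λ q → + 2 * (t * t) * (c₁ * H q) ≈ b₁ * (b₁ * H 1 - t * t * H 2)
                        + E * (+ 2 * (t * t) * (c₁ * H 1) - b₁ * (b₁ * H 1 - t * t * H 2)))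
               (ℕP.suc-pred p {{ℕ.>-nonZero 0<p}})
               (lucas-pred (t * t) b₁ c₁ D discriminant (λ n → H (1 ℕ.+ n)) block₁)
           ⊞ ((E - + 1) * b₁ * (t * t)) ⊙ H-2
           ⊞ (b₁ * b₁ + E * (+ 2 * (t * t) * c₁ - b₁ * b₁)) ⊙ ≈-reflexive H-1)
        (identity t b₁ E (H p) (H 2) (H 1)))
      where
      identity : ∀ t b e h h₂ h₁ → let c = t * (t + + 1) in
        t * t * (t + + 1) * (+ 2 * t * h) - t * t * (t + + 1) * ((e - + 1) * b)
        ≡ + 1 * (+ 2 * (t * t) * (c * h) - (b * (b * h₁ - t * t * h₂) + e * (+ 2 * (t * t) * (c * h₁) - b * (b * h₁ - t * t * h₂))))
        + (e - + 1) * b * (t * t) * (h₂ - (t + + 1))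
        + (b * b + e * (+ 2 * (t * t) * c - b * b)) * (h₁ - + 0)
      identity = solve-∀

    block₂ : ∀ n → 2 ℕ.+ n ℕ.≤ p → t * t * H (1 ℕ.+ (p ℕ.+ (2 ℕ.+ n))) ≈ b₁ * H (1 ℕ.+ (p ℕ.+ (1 ℕ.+ n))) - c₁ * H (1 ℕ.+ (p ℕ.+ n))
    block₂ n n≤ = subst (λ q → t * t * H (1 ℕ.+ q) ≈ b₁ * H (1 ℕ.+ (p ℕ.+ (1 ℕ.+ n))) - c₁ * H (1 ℕ.+ (p ℕ.+ n)))
        (sym (trans (ℕP.+-suc p (1 ℕ.+ n)) (cong suc (ℕP.+-suc p n))))
      (subst (λ q → t * t * H (3 ℕ.+ (p ℕ.+ n)) ≈ b₁ * H (1 ℕ.+ q) - c₁ * H (1 ℕ.+ (p ℕ.+ n)))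
        (sym (ℕP.+-suc p n))
        (H-step (1 ℕ.+ (p ℕ.+ n)) (subst (λ q → residual q ≈ + 0) (ℕP.+-suc p n) (residual-high n n≤))))

    -- Initial values of the second block, in the unreduced form in which `lucas` states them for n
    -- ↦ H (1 + (p + n)).
    s₀ s₁ : ℤ
    s₀ = H (1 ℕ.+ (p ℕ.+ 0))
    s₁ = H (1 ℕ.+ (p ℕ.+ 1))

    s₀≈ : s₀ ≈ E * (t + + 1)
    s₀≈ = ≈-trans (≈-reflexive (cong (λ q → H (1 ℕ.+ q)) (ℕP.+-identityʳ p))) H-1+p

    -- The step across index p, where the inhomogeneous term 3x - 1 enters; it needs the last two
    -- values of the first block.
    2t²s₁≈ : + 2 * (t * t) * s₁ ≈ (E + + 1) * (t + + 1) * b₁ + + 2 * (+ 3 * x - + 1)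
    2t²s₁≈ = ≈-trans (≈-reflexive (cong (λ q → + 2 * (t * t) * H (1 ℕ.+ q)) (ℕP.+-comm p 1)))
      (by (+ 2 ⊙ ≈-trans (≈-reflexive (H-recurrence p)) residual-p ⊞ (+ 2 * b₁) ⊙ H-1+p ⊞ - (t + + 1) ⊙ 2tH-p)
        (identity t b₁ E x (H (2 ℕ.+ p)) (H (1 ℕ.+ p)) (H p)))
      where
      identity : ∀ t b e x h₂ h₁ h₀ →
        + 2 * (t * t) * h₂ - ((e + + 1) * (t + + 1) * b + + 2 * (+ 3 * x - + 1))
        ≡ + 2 * (t * t * h₂ - b * h₁ + t * (t + + 1) * h₀ - (+ 3 * x - + 1))
        + + 2 * b * (h₁ - e * (t + + 1)) + - (t + + 1) * (+ 2 * t * h₀ - (e - + 1) * b)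
      identity = solve-∀

    -- The terms with E² cancel, and (t + 1) b₁ + 3x - 1 = t³ collapses the rest.
    H-1+2p : H (1 ℕ.+ (p ℕ.+ p)) ≈ E * t
    H-1+2p = *-cancelˡ (+ 2 * (t * t)) (H (1 ℕ.+ (p ℕ.+ p))) (E * t) 2t²≉0
      (by (+ 1 ⊙ lucas (t * t) b₁ c₁ D discriminant (λ n → H (1 ℕ.+ (p ℕ.+ n))) block₂
           ⊞ E ⊙ 2t²s₁≈ ⊞ (b₁ - E * b₁) ⊙ s₀≈)
        (identity t E (H (1 ℕ.+ (p ℕ.+ p))) s₀ s₁))
      where
      identity : ∀ t e h s₀ s₁ → let b = (+ 1 - + 2 * t) * (t + + 1) in
        + 2 * (t * t) * h - + 2 * (t * t) * (e * t)
        ≡ + 1 * (+ 2 * (t * t) * h - (b * s₀ + e * (+ 2 * (t * t) * s₁ - b * s₀)))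
        + e * (+ 2 * (t * t) * s₁ - ((e + + 1) * (t + + 1) * b + + 2 * (+ 3 * (t * t * (t + + 1)) - + 1)))
        + (b - e * b) * (s₀ - e * (t + + 1))
      identity = solve-∀

    -- Here E² survives, but only with the factor D, so that `DE²≈D` removes it.
    2H-2p : + 2 * H (p ℕ.+ p) ≈ + 1 + + 4 * t + E * (+ 1 - + 2 * t)
    2H-2p = *-cancelˡ (+ 2 * (t * t * c₁)) (+ 2 * H (p ℕ.+ p)) (+ 1 + + 4 * t + E * (+ 1 - + 2 * t))
      (*≉0 +2≉0 (*≉0 t²≉0 (*≉0 t≉0 t+1≉0)))
      (by (+ 2 ⊙ subst (λ q → + 2 * (t * t) * (c₁ * H q) ≈ b₁ * (b₁ * s₀ - t * t * s₁)
                        + E * (+ 2 * (t * t) * (c₁ * s₀) - b₁ * (b₁ * s₀ - t * t * s₁)))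
               (trans (sym (ℕP.+-suc p (ℕ.pred p))) (cong (p ℕ.+_) (ℕP.suc-pred p {{ℕ.>-nonZero 0<p}})))
               (lucas-pred (t * t) b₁ c₁ D discriminant (λ n → H (1 ℕ.+ (p ℕ.+ n))) block₂)
           ⊞ (+ 2 * (b₁ * b₁ * (+ 1 - E) + + 2 * (t * t) * c₁ * E)) ⊙ s₀≈
           ⊞ (b₁ * (E - + 1)) ⊙ 2t²s₁≈
           ⊞ - (t + + 1) ⊙ DE²≈D)
        (identity t E (H (p ℕ.+ p)) s₀ s₁))
      where
      identity : ∀ t e h s₀ s₁ → let b = (+ 1 - + 2 * t) * (t + + 1); c = t * (t + + 1); D = (+ 1 + t) * (+ 1 - + 3 * t) in
        + 2 * (t * t * c) * (+ 2 * h) - + 2 * (t * t * c) * (+ 1 + + 4 * t + e * (+ 1 - + 2 * t))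
        ≡ + 2 * (+ 2 * (t * t) * (c * h) - (b * (b * s₀ - t * t * s₁) + e * (+ 2 * (t * t) * (c * s₀) - b * (b * s₀ - t * t * s₁))))
        + + 2 * (b * b * (+ 1 - e) + + 2 * (t * t) * c * e) * (s₀ - e * (t + + 1))
        + b * (e - + 1) * (+ 2 * (t * t) * s₁ - ((e + + 1) * (t + + 1) * b + + 2 * (+ 3 * (t * t * (t + + 1)) - + 1)))
        + - (t + + 1) * (D * (e * e) - D)
      identity = solve-∀

    -- Subtracting 1 discards the summand k = 0 of the full sum.
    F-2+p-value : + 2 * (+ 3 * t + + 2) * (F (2 ℕ.+ p) - + 1) ≈ + 3 * (t + + 1) * (t + + 1) * (E - + 1)
    F-2+p-value = by (+ 2 ⊙ ≈-reflexive (F-from-GH p) ⊞ (+ 2 * t) ⊙ G-p ⊞ - (t + + 1) ⊙ 2tH-p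
                       ⊞ (- + 2 * (t + + 1) * (t - + 2)) ⊙ H-1+p)
      (identity t E (F (2 ℕ.+ p)) (G p) (H p) (H (1 ℕ.+ p)))
      where
      identity : ∀ t e f g h₀ h₁ →
        + 2 * (+ 3 * t + + 2) * (f - + 1) - + 3 * (t + + 1) * (t + + 1) * (e - + 1)
        ≡ + 2 * ((+ 3 * t + + 2) * f - (t * (g - (t + + 1) * h₀) - (t + + 1) * (t - + 2) * h₁))
        + + 2 * t * (g - t * t)
        + - (t + + 1) * (+ 2 * t * h₀ - (e - + 1) * ((+ 1 - + 2 * t) * (t + + 1)))
        + - + 2 * (t + + 1) * (t - + 2) * (h₁ - e * (t + + 1))
      identity = solve-∀

    F-2+2p-value : + 2 * (+ 3 * t + + 2) * F (2 ℕ.+ (p ℕ.+ p)) ≈ + 3 * t * (t + + 1) * (E - + 1)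
    F-2+2p-value = by (+ 2 ⊙ ≈-reflexive (F-from-GH (p ℕ.+ p)) ⊞ (+ 2 * t) ⊙ G-2p ⊞ (- t * (t + + 1)) ⊙ 2H-2p
                       ⊞ (- + 2 * (t + + 1) * (t - + 2)) ⊙ H-1+2p)
      (identity t E (F (2 ℕ.+ (p ℕ.+ p))) (G (p ℕ.+ p)) (H (p ℕ.+ p)) (H (1 ℕ.+ (p ℕ.+ p))))
      where
      identity : ∀ t e f g h₀ h₁ →
        + 2 * (+ 3 * t + + 2) * f - + 3 * t * (t + + 1) * (e - + 1)
        ≡ + 2 * ((+ 3 * t + + 2) * f - (t * (g - (t + + 1) * h₀) - (t + + 1) * (t - + 2) * h₁))
        + + 2 * t * (g - (t + + 1) * (+ 2 * t - + 1))
        + - t * (t + + 1) * (+ 2 * h₀ - (+ 1 + + 4 * t + e * (+ 1 - + 2 * t)))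
        + - + 2 * (t + + 1) * (t - + 2) * (h₁ - e * t)
      identity = solve-∀

    W-p-value : + 2 * t * (F (2 ℕ.+ p) - + 2 * F (1 ℕ.+ p) - + 1) ≈ (+ 1 + t) * (+ 1 - + 3 * t) * (+ 1 - E)
    W-p-value = by (+ 2 ⊙ ≈-reflexive (W-from-FH p) ⊞ + 1 ⊙ F-2+p-value ⊞ (- + 4) ⊙ H-1+p)
      (identity t E (F (2 ℕ.+ p)) (F (1 ℕ.+ p)) (H (1 ℕ.+ p)))
      where
      identity : ∀ t e f f′ h →
        + 2 * t * (f - + 2 * f′ - + 1) - (+ 1 + t) * (+ 1 - + 3 * t) * (+ 1 - e)
        ≡ + 2 * (t * (f - + 2 * f′) - ((+ 3 * t + + 2) * f - + 2 * h))
        + + 1 * (+ 2 * (+ 3 * t + + 2) * (f - + 1) - + 3 * (t + + 1) * (t + + 1) * (e - + 1))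
        + - + 4 * (h - e * (t + + 1))
      identity = solve-∀

    W-2p-value : + 2 * t * (F (2 ℕ.+ (p ℕ.+ p)) - + 2 * F (1 ℕ.+ (p ℕ.+ p))) ≈ + 3 * t * (t + + 1) * (E - + 1) - + 4 * E * t
    W-2p-value = by (+ 2 ⊙ ≈-reflexive (W-from-FH (p ℕ.+ p)) ⊞ + 1 ⊙ F-2+2p-value ⊞ (- + 4) ⊙ H-1+2p)
      (identity t E (F (2 ℕ.+ (p ℕ.+ p))) (F (1 ℕ.+ (p ℕ.+ p))) (H (1 ℕ.+ (p ℕ.+ p))))
      where
      identity : ∀ t e f f′ h →
        + 2 * t * (f - + 2 * f′) - (+ 3 * t * (t + + 1) * (e - + 1) - + 4 * e * t)
        ≡ + 2 * (t * (f - + 2 * f′) - ((+ 3 * t + + 2) * f - + 2 * h))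
        + + 1 * (+ 2 * (+ 3 * t + + 2) * f - + 3 * t * (t + + 1) * (e - + 1))
        + - + 4 * (h - e * t)
      identity = solve-∀

  -- From coefficients of F to the full and the truncated sums.

  -- The binomial coefficients that occur in F at y^(2p-1) and y^(2p-2).
  central′ subcentral′ : ℕ → ℤ
  central′    k = choose (3 ℕ.* k) (p ℕ.+ k)
  subcentral′ k = choose (3 ℕ.* k) (ℕ.pred p ℕ.+ k)

  weighted : (ℕ → ℤ) → ℕ → ℤ
  weighted f k = f k * x ^ k

  tail : (ℕ → ℤ) → ℕ → ℤ
  tail f n = Σ< n (λ k → weighted f (suc k))

  F-2+p : F (2 ℕ.+ p) ≡ Σ< p (weighted central)
  F-2+p = Σ<-cong p (λ k _ → trans (cong (x ^ k *_) (shifted-at (2 ℕ.+ p) (choose (3 ℕ.* k)) k)) (ℤP.*-comm (x ^ k) (central k)))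

  F-1+p : F (1 ℕ.+ p) ≡ Σ< p (weighted subcentral)
  F-1+p = Σ<-cong p (λ k _ → trans (cong (x ^ k *_) (entry k)) (ℤP.*-comm (x ^ k) (subcentral k)))
    where
    entry : ∀ k → shifted (2 ℕ.+ p) (choose (3 ℕ.* k)) (1 ℕ.+ p ℕ.+ k) ≡ subcentral k
    entry zero    = shifted-below (1 ℕ.+ p) (choose 0) (p ℕ.+ 0) (s≤s (ℕP.≤-reflexive (ℕP.+-identityʳ p)))
    entry (suc k) = trans (cong (shifted (1 ℕ.+ p) (choose (3 ℕ.* suc k))) (ℕP.+-suc p k)) (shifted-at p (choose (3 ℕ.* suc k)) k)

  F-2+2p : F (2 ℕ.+ (p ℕ.+ p)) ≡ Σ< p (weighted central′)
  F-2+2p = Σ<-cong p (λ k _ → trans (cong (x ^ k *_)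
      (trans (cong (shifted p (choose (3 ℕ.* k))) (ℕP.+-assoc p p k)) (shifted-at p (choose (3 ℕ.* k)) (p ℕ.+ k))))
    (ℤP.*-comm (x ^ k) (central′ k)))

  1+pred-p : suc (ℕ.pred p) ≡ p
  1+pred-p = ℕP.suc-pred p {{ℕ.>-nonZero 0<p}}

  F-1+2p : F (1 ℕ.+ (p ℕ.+ p)) ≡ Σ< p (weighted subcentral′)
  F-1+2p = Σ<-cong p (λ k _ → trans (cong (x ^ k *_)
      (trans (cong (shifted (1 ℕ.+ p) (choose (3 ℕ.* k))) (index k)) (shifted-at p (choose (3 ℕ.* k)) (ℕ.pred p ℕ.+ k))))
    (ℤP.*-comm (x ^ k) (subcentral′ k)))
    where
    index : ∀ k → p ℕ.+ p ℕ.+ k ≡ suc (p ℕ.+ (ℕ.pred p ℕ.+ k))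
    index k = trans (ℕP.+-assoc p p k) (trans (cong (λ q → p ℕ.+ (q ℕ.+ k)) (sym 1+pred-p)) (ℕP.+-suc p (ℕ.pred p ℕ.+ k)))

  Σ<-linear : ∀ f g → Σ< p (weighted (λ k → f k - + 2 * g k)) ≡ Σ< p (weighted f) - + 2 * Σ< p (weighted g)
  Σ<-linear f g = trans (Σ<-cong p (λ k _ → identity (f k) (g k) (x ^ k)))
    (trans (Σ<-+ p (weighted f) (λ k → - + 2 * weighted g k))
      (trans (cong (λ s → Σ< p (weighted f) + s) (Σ<-* p (- + 2) (weighted g))) (identity′ (Σ< p (weighted f)) (Σ< p (weighted g)))))
    where
    identity : ∀ a b y → (a - + 2 * b) * y ≡ a * y + - + 2 * (b * y)
    identity = solve-∀
    identity′ : ∀ a b → a + - + 2 * b ≡ a - + 2 * b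
    identity′ = solve-∀

  Σ<-truncate : ∀ {n} N f → n ℕ.≤ N → (∀ k → n ℕ.≤ k → k ℕ.< N → f k ≈ + 0) → Σ< N f ≈ Σ< n f
  Σ<-truncate {n} N f n≤N f≈0 with ℕP.m≤n⇒m<n∨m≡n n≤N
  ... | inj₂ refl = ≈-refl
  Σ<-truncate {n} (suc N) f _ f≈0 | inj₁ (s≤s n≤N) = ≈-trans
    (+-cong (Σ<-truncate N f n≤N (λ k n≤k k<N → f≈0 k n≤k (ℕP.m<n⇒m<1+n k<N))) (f≈0 N n≤N ℕP.≤-refl))
    (≈-reflexive (ℤP.+-identityʳ (Σ< n f)))

  Σ<-tail : ∀ f n → f 0 ≡ + 1 → Σ< (suc n) (weighted f) ≡ + 1 + tail f n
  Σ<-tail f n f0≡1 = trans (Σ<-head n (weighted f)) (cong (λ s → s * + 1 + tail f n) f0≡1)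

  3k≤p : ∀ k → k ℕ.≤ p ℕ./ 3 → 3 ℕ.* k ℕ.≤ p
  3k≤p k k≤ = ℕP.≤-trans (ℕP.*-monoʳ-≤ 3 k≤) (ℕP.≤-trans (ℕP.≤-reflexive (ℕP.*-comm 3 (p ℕ./ 3))) (ℕDM.m/n*n≤m p 3))

  p≤3k : ∀ k → suc (p ℕ./ 3) ℕ.≤ k → p ℕ.≤ 3 ℕ.* k
  p≤3k k q<k = ℕP.≤-trans (ℕP.<⇒≤ (ℕP.≤-<-trans (ℕP.≤-reflexive (ℕDM.m≡m%n+[m/n]*n p 3)) (ℕP.+-monoˡ-< (p ℕ./ 3 ℕ.* 3) (ℕDM.m%n<n p 3))))
    (ℕP.≤-trans (ℕP.≤-reflexive (ℕP.*-comm (suc (p ℕ./ 3)) 3)) (ℕP.*-monoʳ-≤ 3 q<k))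

  -- f′ reproduces f modulo p in the range p ≤ 3k and vanishes for 3k ≤ p, so
  -- that subtracting it truncates the sum.
  Σ<-short : ∀ f f′ → f 0 ≡ + 1 → (∀ k → k ℕ.< p → p ℕ.≤ 3 ℕ.* k → f k ≈ f′ k) →
    (∀ k → 3 ℕ.* k ℕ.≤ p → f′ k ≡ + 0) → tail f (p ℕ./ 3) ≈ Σ< p (weighted f) - Σ< p (weighted f′) - + 1
  Σ<-short f f′ f0≡1 f≈f′ f′≡0 = ≈-sym (begin
    Σ< p (weighted f) - Σ< p (weighted f′) - + 1
      ≡⟨ cong (_- + 1) difference ⟩
    Σ< p (λ k → weighted f k + - + 1 * weighted f′ k) - + 1
      ≈⟨ minus-cong (Σ<-truncate p _ (ℕDM.m/n<m p 3 {{ℕ.>-nonZero 0<p}} (s≤s (s≤s z≤n)))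
           (λ k q<k k<p → by (x ^ k ⊙ f≈f′ k k<p (p≤3k k q<k)) (factor (f k) (f′ k) (x ^ k)))) (≈-refl {+ 1}) ⟩
    Σ< (suc (p ℕ./ 3)) (λ k → weighted f k + - + 1 * weighted f′ k) - + 1
      ≡⟨ cong (_- + 1) (Σ<-cong (suc (p ℕ./ 3)) (λ k k≤q →
           trans (cong (λ s → weighted f k + - + 1 * (s * x ^ k)) (f′≡0 k (3k≤p k (ℕP.≤-pred k≤q)))) (drop (weighted f k) (x ^ k)))) ⟩
    Σ< (suc (p ℕ./ 3)) (weighted f) - + 1
      ≡⟨ cong (_- + 1) (Σ<-tail f (p ℕ./ 3) f0≡1) ⟩
    + 1 + tail f (p ℕ./ 3) - + 1
      ≡⟨ cancel (tail f (p ℕ./ 3)) ⟩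
    tail f (p ℕ./ 3) ∎)
    where
    open ≈-Reasoning
    difference : Σ< p (weighted f) - Σ< p (weighted f′) ≡ Σ< p (λ k → weighted f k + - + 1 * weighted f′ k)
    difference = trans (negate (Σ< p (weighted f)) (Σ< p (weighted f′)))
      (trans (cong (λ s → Σ< p (weighted f) + s) (sym (Σ<-* p (- + 1) (weighted f′))))
        (sym (Σ<-+ p (weighted f) (λ k → - + 1 * weighted f′ k))))
      where
      negate : ∀ a b → a - b ≡ a + - + 1 * b
      negate = solve-∀
    factor : ∀ a b y → a * y + - + 1 * (b * y) - + 0 ≡ y * (a - b)
    factor = solve-∀
    drop : ∀ a y → a + - + 1 * (+ 0 * y) ≡ a
    drop = solve-∀
    cancel : ∀ a → + 1 + a - + 1 ≡ a
    cancel = solve-∀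

  3*≡ : ∀ k → 3 ℕ.* k ≡ k ℕ.+ k ℕ.+ k
  3*≡ = ℕR.solve-∀

  -- With 3k = p + r both sides reduce to C(r, k); the extra term C(r, p + k) vanishes because k < p
  -- gives 3k < 2p + k.
  central≈central′ : ∀ k → k ℕ.< p → p ℕ.≤ 3 ℕ.* k → central k ≈ central′ k
  central≈central′ k k<p p≤3k = subst (λ n → choose n k ≈ choose n (p ℕ.+ k)) (ℕP.m+[n∸m]≡n p≤3k) (begin
    choose (p ℕ.+ r) k                ≈⟨ choose-p+-low r k k<p ⟩
    choose r k                        ≡⟨ ℤP.+-identityˡ (choose r k) ⟨
    + 0 + choose r k                  ≡⟨ cong (_+ choose r k) (choose-zero r<) ⟨
    choose r (p ℕ.+ k) + choose r k   ≈⟨ choose-p+-high r k ⟨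
    choose (p ℕ.+ r) (p ℕ.+ k)        ∎)
    where
    open ≈-Reasoning
    r : ℕ
    r = 3 ℕ.* k ∸ p
    r< : r ℕ.< p ℕ.+ k
    r< = ℕP.+-cancelˡ-< p r (p ℕ.+ k) (subst (ℕ._< p ℕ.+ (p ℕ.+ k)) (trans (sym (3*≡ k)) (sym (ℕP.m+[n∸m]≡n p≤3k)))
      (subst (k ℕ.+ k ℕ.+ k ℕ.<_) (ℕP.+-assoc p p k) (ℕP.+-monoˡ-< k (ℕP.+-mono-< k<p k<p))))

  subcentral≈subcentral′ : ∀ k → k ℕ.< p → p ℕ.≤ 3 ℕ.* k → subcentral k ≈ subcentral′ k
  subcentral≈subcentral′ zero    _   p≤0  = ⊥-elim (ℕP.<⇒≱ 0<p p≤0)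
  subcentral≈subcentral′ (suc k) k<p p≤3k = subst (λ i → choose (3 ℕ.* suc k) k ≈ choose (3 ℕ.* suc k) i) index
    (subst (λ n → choose n k ≈ choose n (p ℕ.+ k)) (ℕP.m+[n∸m]≡n p≤3k) (begin
      choose (p ℕ.+ r) k                ≈⟨ choose-p+-low r k (ℕP.<-trans (ℕP.n<1+n k) k<p) ⟩
      choose r k                        ≡⟨ ℤP.+-identityˡ (choose r k) ⟨
      + 0 + choose r k                  ≡⟨ cong (_+ choose r k) (choose-zero r<) ⟨
      choose r (p ℕ.+ k) + choose r k   ≈⟨ choose-p+-high r k ⟨
      choose (p ℕ.+ r) (p ℕ.+ k)        ∎))
    where
    open ≈-Reasoning
    index : p ℕ.+ k ≡ ℕ.pred p ℕ.+ suc k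
    index = trans (cong (ℕ._+ k) (sym 1+pred-p)) (sym (ℕP.+-suc (ℕ.pred p) k))
    r : ℕ
    r = 3 ℕ.* suc k ∸ p
    -- Here 3(k + 1) < 2p + k is needed, and it follows from k + 2 ≤ p.
    rearrange : ∀ k → suc (3 ℕ.* suc k) ≡ suc (suc k) ℕ.+ suc (suc k) ℕ.+ k
    rearrange = ℕR.solve-∀
    r< : r ℕ.< p ℕ.+ k
    r< = ℕP.+-cancelˡ-< p r (p ℕ.+ k) (subst (ℕ._< p ℕ.+ (p ℕ.+ k)) (sym (ℕP.m+[n∸m]≡n p≤3k))
      (subst (ℕ._≤ p ℕ.+ (p ℕ.+ k)) (sym (rearrange k))
        (subst (suc (suc k) ℕ.+ suc (suc k) ℕ.+ k ℕ.≤_) (ℕP.+-assoc p p k) (ℕP.+-monoˡ-≤ k (ℕP.+-mono-≤ k<p k<p)))))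

  -- Places 3k below p - 1 + k, where both correction terms vanish. For k ≥ 2 already 3k ≥ 2k + 2;
  -- for k = 1 the claim is p > 3.
  2+2k≤p : ∀ k → 3 ℕ.* k ℕ.≤ p → suc (k ℕ.+ k) ℕ.< p
  2+2k≤p zero          _    = 1<p
  2+2k≤p (suc zero)    _    = p>3
  2+2k≤p (suc (suc k)) 3k≤p = ℕP.≤-trans (subst (suc (suc (suc (suc k) ℕ.+ suc (suc k))) ℕ.≤_) (sym (rearrange k)) (ℕP.m≤n+m _ k)) 3k≤p
    where
    rearrange : ∀ k → 3 ℕ.* suc (suc k) ≡ k ℕ.+ suc (suc (suc (suc k) ℕ.+ suc (suc k)))
    rearrange = ℕR.solve-∀

  central′≡0 : ∀ k → 3 ℕ.* k ℕ.≤ p → central′ k ≡ + 0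
  central′≡0 k 3k≤p = choose-zero (subst (ℕ._< p ℕ.+ k) (sym (3*≡ k)) (ℕP.+-monoˡ-< k (ℕP.<-trans (ℕP.n<1+n _) (2+2k≤p k 3k≤p))))

  subcentral′≡0 : ∀ k → 3 ℕ.* k ℕ.≤ p → subcentral′ k ≡ + 0
  subcentral′≡0 k 3k≤p = choose-zero (subst (ℕ._< ℕ.pred p ℕ.+ k) (sym (3*≡ k))
    (ℕP.+-monoˡ-< k (ℕP.≤-pred (subst (suc (suc (k ℕ.+ k)) ℕ.≤_) (sym 1+pred-p) (2+2k≤p k 3k≤p)))))

  tail-full : ∀ f → f 0 ≡ + 1 → tail f (ℕ.pred p) ≡ Σ< p (weighted f) - + 1
  tail-full f f0≡1 = sym (trans (cong (_- + 1) (trans (cong (λ n → Σ< n (weighted f)) (sym 1+pred-p)) (Σ<-tail f (ℕ.pred p) f0≡1)))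
    (cancel (tail f (ℕ.pred p))))
    where
    cancel : ∀ a → + 1 + a - + 1 ≡ a
    cancel = solve-∀

  tail-central-full : tail central (ℕ.pred p) ≡ F (2 ℕ.+ p) - + 1
  tail-central-full = trans (tail-full central refl) (cong (_- + 1) (sym F-2+p))

  tail-catalan-full : tail catalan (ℕ.pred p) ≡ F (2 ℕ.+ p) - + 2 * F (1 ℕ.+ p) - + 1
  tail-catalan-full = trans (tail-full catalan refl) (cong (_- + 1) (trans (Σ<-linear central subcentral)
    (sym (cong₂ (λ a b → a - + 2 * b) F-2+p F-1+p))))

  tail-central-short : tail central (p ℕ./ 3) ≈ F (2 ℕ.+ p) - F (2 ℕ.+ (p ℕ.+ p)) - + 1
  tail-central-short = ≈-trans (Σ<-short central central′ refl central≈central′ central′≡0)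
    (≈-reflexive (sym (cong₂ (λ a b → a - b - + 1) F-2+p F-2+2p)))

  tail-catalan-short : tail catalan (p ℕ./ 3) ≈
    (F (2 ℕ.+ p) - + 2 * F (1 ℕ.+ p)) - (F (2 ℕ.+ (p ℕ.+ p)) - + 2 * F (1 ℕ.+ (p ℕ.+ p))) - + 1
  tail-catalan-short = ≈-trans
    (Σ<-short catalan (λ k → central′ k - + 2 * subcentral′ k) refl
      (λ k k<p p≤ → minus-cong (central≈central′ k k<p p≤) (*-congˡ (+ 2) (subcentral≈subcentral′ k k<p p≤)))
      (λ k ≤p → cong₂ (λ a b → a - + 2 * b) (central′≡0 k ≤p) (subcentral′≡0 k ≤p)))
    (≈-reflexive (cong₂ (λ a b → a - b - + 1)
      (trans (Σ<-linear central subcentral) (sym (cong₂ (λ a b → a - + 2 * b) F-2+p F-1+p)))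
      (trans (Σ<-linear central′ subcentral′) (sym (cong₂ (λ a b → a - + 2 * b) F-2+2p F-1+2p)))))

  -- The degenerate cases and the four congruences over the integers.

  -- The sums start at k = 1, so each summand carries a factor x.
  tail≈0 : ∀ f n → x ≈ + 0 → tail f n ≈ + 0
  tail≈0 f n x≈0 = ≈-trans (Σ<-cong-≈ n (λ k _ → by ((f (suc k) * x ^ k) ⊙ x≈0) (factor (f (suc k)) x (x ^ k))))
    (≈-reflexive (Σ<-zero n))
    where
    factor : ∀ a x y → a * (x * y) - + 0 ≡ a * y * (x - + 0)
    factor = solve-∀

  t≈0⇒x≈0 : t ≈ + 0 → x ≈ + 0
  t≈0⇒x≈0 h = by ((t * (t + + 1)) ⊙ h) (identity t)
    where
    identity : ∀ t → t * t * (t + + 1) - + 0 ≡ t * (t + + 1) * (t - + 0)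
    identity = solve-∀

  t+1≈0⇒x≈0 : t + + 1 ≈ + 0 → x ≈ + 0
  t+1≈0⇒x≈0 h = by ((t * t) ⊙ h) (identity t)
    where
    identity : ∀ t → t * t * (t + + 1) - + 0 ≡ t * t * (t + + 1 - + 0)
    identity = solve-∀

  t≈0⇒E≈1 : t ≈ + 0 → E ≈ + 1
  t≈0⇒E≈1 h = ≈-trans (^-cong m (by ((- + 3 * t - + 2) ⊙ h) (identity t))) (≈-reflexive (ℤP.^-zeroˡ m))
    where
    identity : ∀ t → (+ 1 + t) * (+ 1 - + 3 * t) - + 1 ≡ (- + 3 * t - + 2) * (t - + 0)
    identity = solve-∀

  t+1≈0⇒E≈0 : t + + 1 ≈ + 0 → E ≈ + 0
  t+1≈0⇒E≈0 h = 0^m≈0 D (by ((+ 1 - + 3 * t) ⊙ h) (identity t))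
    where
    identity : ∀ t → (+ 1 + t) * (+ 1 - + 3 * t) - + 0 ≡ (+ 1 - + 3 * t) * (t + + 1 - + 0)
    identity = solve-∀

  -- The difference of the values at p and 2p simplifies by (1 + t)(1 - 3t) + 3t(t + 1) = 1 + t. If
  -- t + 1 ≡ 0, then E ≡ 0 as well and both sides vanish.
  catalan-short : ¬ t ≈ + 0 → + 2 * t * tail catalan (p ℕ./ 3) ≈ (+ 1 + t) - (+ 1 - + 3 * t) * E
  catalan-short t≉0 with (t + + 1) ≈0?
  ... | yes h = by ((+ 2 * t) ⊙ tail≈0 catalan (p ℕ./ 3) (t+1≈0⇒x≈0 h) ⊞ - + 1 ⊙ h ⊞ (+ 1 - + 3 * t) ⊙ t+1≈0⇒E≈0 h)
      (identity t (tail catalan (p ℕ./ 3)) E)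
    where
    identity : ∀ t s e → + 2 * t * s - ((+ 1 + t) - (+ 1 - + 3 * t) * e)
      ≡ + 2 * t * (s - + 0) + - + 1 * (t + + 1 - + 0) + (+ 1 - + 3 * t) * (e - + 0)
    identity = solve-∀
  ... | no t+1≉0 = by ((+ 2 * t) ⊙ tail-catalan-short ⊞ + 1 ⊙ W-p-value ⊞ - + 1 ⊙ W-2p-value)
      (identity t (tail catalan (p ℕ./ 3)) E (F (2 ℕ.+ p) - + 2 * F (1 ℕ.+ p)) (F (2 ℕ.+ (p ℕ.+ p)) - + 2 * F (1 ℕ.+ (p ℕ.+ p))))
    where
    open Generic t≉0 t+1≉0
    identity : ∀ t s e w w′ → + 2 * t * s - ((+ 1 + t) - (+ 1 - + 3 * t) * e)
      ≡ + 2 * t * (s - (w - w′ - + 1)) + + 1 * (+ 2 * t * (w - + 1) - (+ 1 + t) * (+ 1 - + 3 * t) * (+ 1 - e))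
      + - + 1 * (+ 2 * t * w′ - (+ 3 * t * (t + + 1) * (e - + 1) - + 4 * e * t))
    identity = solve-∀

  catalan-full : ¬ t ≈ + 0 → + 2 * t * tail catalan (ℕ.pred p) ≈ (+ 1 + t) * (+ 1 - + 3 * t) * (+ 1 - E)
  catalan-full t≉0 with (t + + 1) ≈0?
  ... | yes h = by ((+ 2 * t) ⊙ tail≈0 catalan (ℕ.pred p) (t+1≈0⇒x≈0 h) ⊞ - ((+ 1 - + 3 * t) * (+ 1 - E)) ⊙ h)
      (identity t (tail catalan (ℕ.pred p)) E)
    where
    identity : ∀ t s e → + 2 * t * s - (+ 1 + t) * (+ 1 - + 3 * t) * (+ 1 - e)
      ≡ + 2 * t * (s - + 0) + - ((+ 1 - + 3 * t) * (+ 1 - e)) * (t + + 1 - + 0)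
    identity = solve-∀
  ... | no t+1≉0 = ≈-trans (≈-reflexive (cong (+ 2 * t *_) tail-catalan-full)) (Generic.W-p-value t≉0 t+1≉0)

  binomial-full : + 2 * (+ 3 * t + + 2) * tail central (ℕ.pred p) ≈ + 3 * (t + + 1) * (t + + 1) * (E - + 1)
  binomial-full with t ≈0? | (t + + 1) ≈0?
  -- For t ≡ 0 the discriminant is 1, so the factor E - 1 on the right vanishes.
  ... | yes h | _ = by ((+ 2 * (+ 3 * t + + 2)) ⊙ tail≈0 central (ℕ.pred p) (t≈0⇒x≈0 h) ⊞ - (+ 3 * (t + + 1) * (t + + 1)) ⊙ t≈0⇒E≈1 h)
      (identity (+ 2 * (+ 3 * t + + 2)) (+ 3 * (t + + 1) * (t + + 1)) (tail central (ℕ.pred p)) E)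
    where
    identity : ∀ a b s e → a * s - b * (e - + 1) ≡ a * (s - + 0) + - b * (e - + 1)
    identity = solve-∀
  ... | no _ | yes h = by ((+ 2 * (+ 3 * t + + 2)) ⊙ tail≈0 central (ℕ.pred p) (t+1≈0⇒x≈0 h) ⊞ - (+ 3 * (t + + 1) * (E - + 1)) ⊙ h)
      (identity t (tail central (ℕ.pred p)) E)
    where
    identity : ∀ t s e → + 2 * (+ 3 * t + + 2) * s - + 3 * (t + + 1) * (t + + 1) * (e - + 1)
      ≡ + 2 * (+ 3 * t + + 2) * (s - + 0) + - (+ 3 * (t + + 1) * (e - + 1)) * (t + + 1 - + 0)
    identity = solve-∀
  ... | no t≉0 | no t+1≉0 = ≈-trans (≈-reflexive (cong (+ 2 * (+ 3 * t + + 2) *_) tail-central-full)) (Generic.F-2+p-value t≉0 t+1≉0)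

  -- In the generic case, (t + 1)² - t(t + 1) = t + 1 gives the difference of the values at p and
  -- 2p.
  binomial-short : + 2 * (+ 3 * t + + 2) * tail central (p ℕ./ 3) ≈ + 3 * (t + + 1) * (E - + 1)
  binomial-short with t ≈0? | (t + + 1) ≈0?
  ... | yes h | _ = by ((+ 2 * (+ 3 * t + + 2)) ⊙ tail≈0 central (p ℕ./ 3) (t≈0⇒x≈0 h) ⊞ - (+ 3 * (t + + 1)) ⊙ t≈0⇒E≈1 h)
      (identity (+ 2 * (+ 3 * t + + 2)) (+ 3 * (t + + 1)) (tail central (p ℕ./ 3)) E)
    where
    identity : ∀ a b s e → a * s - b * (e - + 1) ≡ a * (s - + 0) + - b * (e - + 1)
    identity = solve-∀
  ... | no _ | yes h = by ((+ 2 * (+ 3 * t + + 2)) ⊙ tail≈0 central (p ℕ./ 3) (t+1≈0⇒x≈0 h) ⊞ - (+ 3 * (E - + 1)) ⊙ h)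
      (identity t (tail central (p ℕ./ 3)) E)
    where
    identity : ∀ t s e → + 2 * (+ 3 * t + + 2) * s - + 3 * (t + + 1) * (e - + 1)
      ≡ + 2 * (+ 3 * t + + 2) * (s - + 0) + - (+ 3 * (e - + 1)) * (t + + 1 - + 0)
    identity = solve-∀
  ... | no t≉0 | no t+1≉0 = by ((+ 2 * (+ 3 * t + + 2)) ⊙ tail-central-short ⊞ + 1 ⊙ F-2+p-value ⊞ - + 1 ⊙ F-2+2p-value)
      (identity t (tail central (p ℕ./ 3)) E (F (2 ℕ.+ p)) (F (2 ℕ.+ (p ℕ.+ p))))
    where
    open Generic t≉0 t+1≉0
    identity : ∀ t s e w w′ → + 2 * (+ 3 * t + + 2) * s - + 3 * (t + + 1) * (e - + 1)
      ≡ + 2 * (+ 3 * t + + 2) * (s - (w - w′ - + 1)) + + 1 * (+ 2 * (+ 3 * t + + 2) * (w - + 1) - + 3 * (t + + 1) * (t + + 1) * (e - + 1))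
      + - + 1 * (+ 2 * (+ 3 * t + + 2) * w′ - + 3 * t * (t + + 1) * (e - + 1))
    identity = solve-∀

-- The embedding of the integers into the rationals.

module IntegersInRationals where
  open Rat using (_+_; _*_; _-_; -_)

  ι : ℤ → ℚ
  ι a = a Rat./ 1

  ι-injective : ∀ {a b} → ι a ≡ ι b → a ≡ b
  ι-injective {a} {b} eq with ℚP.fromℚᵘ-injective {ℚᵘ.mkℚᵘ a 0} {ℚᵘ.mkℚᵘ b 0} eq
  ... | ℚᵘ.*≡* h = trans (sym (ℤP.*-identityʳ a)) (trans h (ℤP.*-identityʳ b))

  ι-+ : ∀ a b → ι (a Int.+ b) ≡ ι a + ι b
  ι-+ a b = ℚP.toℚᵘ-injective (begin
    Rat.toℚᵘ (ι (a Int.+ b))                    ≈⟨ ℚP.toℚᵘ-fromℚᵘ (ℚᵘ.mkℚᵘ (a Int.+ b) 0) ⟩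
    ℚᵘ.mkℚᵘ (a Int.+ b) 0                       ≈⟨ ℚᵘ.*≡* (identity a b) ⟩
    ℚᵘ.mkℚᵘ a 0 ℚᵘ.+ ℚᵘ.mkℚᵘ b 0                ≈⟨ ℚᵘP.+-cong (ℚP.toℚᵘ-fromℚᵘ (ℚᵘ.mkℚᵘ a 0)) (ℚP.toℚᵘ-fromℚᵘ (ℚᵘ.mkℚᵘ b 0)) ⟨
    Rat.toℚᵘ (ι a) ℚᵘ.+ Rat.toℚᵘ (ι b)          ≈⟨ ℚP.toℚᵘ-homo-+ (ι a) (ι b) ⟨
    Rat.toℚᵘ (ι a + ι b)                        ∎)
    where
    open Relation.Binary.Reasoning.Setoid ℚᵘP.≃-setoid
    identity : ∀ a b → (a Int.+ b) Int.* + 1 ≡ (a Int.* + 1 Int.+ b Int.* + 1) Int.* + 1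
    identity = solve-∀

  ι-* : ∀ a b → ι (a Int.* b) ≡ ι a * ι b
  ι-* a b = ℚP.toℚᵘ-injective (begin
    Rat.toℚᵘ (ι (a Int.* b))                    ≈⟨ ℚP.toℚᵘ-fromℚᵘ (ℚᵘ.mkℚᵘ (a Int.* b) 0) ⟩
    ℚᵘ.mkℚᵘ a 0 ℚᵘ.* ℚᵘ.mkℚᵘ b 0                ≈⟨ ℚᵘP.*-cong (ℚP.toℚᵘ-fromℚᵘ (ℚᵘ.mkℚᵘ a 0)) (ℚP.toℚᵘ-fromℚᵘ (ℚᵘ.mkℚᵘ b 0)) ⟨
    Rat.toℚᵘ (ι a) ℚᵘ.* Rat.toℚᵘ (ι b)          ≈⟨ ℚP.toℚᵘ-homo-* (ι a) (ι b) ⟨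
    Rat.toℚᵘ (ι a * ι b)                        ∎)
    where open Relation.Binary.Reasoning.Setoid ℚᵘP.≃-setoid

  ι-neg : ∀ a → ι (Int.- a) ≡ - ι a
  ι-neg a = ℚP.toℚᵘ-injective (begin
    Rat.toℚᵘ (ι (Int.- a))          ≈⟨ ℚP.toℚᵘ-fromℚᵘ (ℚᵘ.mkℚᵘ (Int.- a) 0) ⟩
    ℚᵘ.- ℚᵘ.mkℚᵘ a 0                ≈⟨ ℚᵘP.-‿cong (ℚP.toℚᵘ-fromℚᵘ (ℚᵘ.mkℚᵘ a 0)) ⟨
    ℚᵘ.- Rat.toℚᵘ (ι a)             ≈⟨ ℚP.toℚᵘ-homo‿- (ι a) ⟨
    Rat.toℚᵘ (- ι a)                ∎)
    where open Relation.Binary.Reasoning.Setoid ℚᵘP.≃-setoid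

  *-denominator : ∀ z → z * ι (Rat.↧ z) ≡ ι (Rat.↥ z)
  *-denominator z@record{} = ℚP.toℚᵘ-injective (begin
    Rat.toℚᵘ (z * ι (Rat.↧ z))                   ≈⟨ ℚP.toℚᵘ-homo-* z (ι (Rat.↧ z)) ⟩
    Rat.toℚᵘ z ℚᵘ.* Rat.toℚᵘ (ι (Rat.↧ z))       ≈⟨ ℚᵘP.*-congˡ {Rat.toℚᵘ z} (ℚP.toℚᵘ-fromℚᵘ (ℚᵘ.mkℚᵘ (Rat.↧ z) 0)) ⟩
    Rat.toℚᵘ z ℚᵘ.* ℚᵘ.mkℚᵘ (Rat.↧ z) 0          ≈⟨ ℚᵘ.*≡* (identity (Rat.↥ z) (Rat.↧ z)) ⟩
    ℚᵘ.mkℚᵘ (Rat.↥ z) 0                          ≈⟨ ℚP.toℚᵘ-fromℚᵘ (ℚᵘ.mkℚᵘ (Rat.↥ z) 0) ⟨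
    Rat.toℚᵘ (ι (Rat.↥ z))                       ∎)
    where
    open Relation.Binary.Reasoning.Setoid ℚᵘP.≃-setoid
    identity : ∀ n d → n Int.* d Int.* + 1 ≡ n Int.* (d Int.* + 1)
    identity = solve-∀

  cross-multiply : ∀ z a b → z * ι b ≡ ι a → Rat.↥ z Int.* b ≡ a Int.* Rat.↧ z
  cross-multiply z a b eq = ι-injective (begin
    ι (Rat.↥ z Int.* b)           ≡⟨ ι-* (Rat.↥ z) b ⟩
    ι (Rat.↥ z) * ι b             ≡⟨ cong (_* ι b) (*-denominator z) ⟨
    z * ι (Rat.↧ z) * ι b         ≡⟨ swap z (ι (Rat.↧ z)) (ι b) ⟩
    z * ι b * ι (Rat.↧ z)         ≡⟨ cong (_* ι (Rat.↧ z)) eq ⟩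
    ι a * ι (Rat.↧ z)             ≡⟨ ι-* a (Rat.↧ z) ⟨
    ι (a Int.* Rat.↧ z)           ∎)
    where
    open ≡-Reasoning
    swap : ∀ z d b → z * d * b ≡ z * b * d
    swap = ℚS.solve 3 (λ z d b → z ℚS.:* d ℚS.:* b ℚS.:= z ℚS.:* b ℚS.:* d) refl

open IntegersInRationals

-- Residues modulo p of the elements of D_p.

module Reduction (p : ℕ) (p-prime : Prime p) (m : ℕ) (0<m : 0 ℕ.< m) (p≡1+2m : p ≡ suc (m ℕ.+ m)) where
  open OddPrimeCongruence p p-prime m 0<m p≡1+2m
  open Rat using (_+_; _*_; _-_; -_)

  -- x lies in D_p and has residue n: some representation of x as a fraction
  -- num / den with p ∤ den satisfies num ≡ n · den.
  infix 4 _↦_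
  record _↦_ (x : ℚ) (n : ℤ) : Set where
    field
      num den  : ℤ
      den≉0    : ¬ den ≈ + 0
      fraction : x * ι den ≡ ι num
      residual : num ≈ n Int.* den
  open _↦_

  private variable
    x y : ℚ
    a b e : ℤ

  +1≉0 : ¬ + 1 ≈ + 0
  +1≉0 = +n≉0 (s≤s z≤n) 1<p

  ι-↦ : ∀ a → ι a ↦ a
  ι-↦ a = record { num = a ; den = + 1 ; den≉0 = +1≉0 ; fraction = ℚP.*-identityʳ (ι a)
    ; residual = ≈-reflexive (sym (ℤP.*-identityʳ a)) }

  +-↦ : x ↦ a → y ↦ b → x + y ↦ a Int.+ b
  +-↦ {x} {a} {y} {b} h k = record
    { num      = num h Int.* den k Int.+ num k Int.* den h
    ; den      = den h Int.* den k
    ; den≉0    = *≉0 (den≉0 h) (den≉0 k)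
    ; fraction = begin
        (x + y) * ι (den h Int.* den k)                         ≡⟨ cong ((x + y) *_) (ι-* (den h) (den k)) ⟩
        (x + y) * (ι (den h) * ι (den k))                       ≡⟨ expand x y (ι (den h)) (ι (den k)) ⟩
        x * ι (den h) * ι (den k) + y * ι (den k) * ι (den h)   ≡⟨ cong₂ (λ u v → u * ι (den k) + v * ι (den h)) (fraction h) (fraction k) ⟩
        ι (num h) * ι (den k) + ι (num k) * ι (den h)           ≡⟨ cong₂ _+_ (ι-* (num h) (den k)) (ι-* (num k) (den h)) ⟨
        ι (num h Int.* den k) + ι (num k Int.* den h)           ≡⟨ ι-+ (num h Int.* den k) (num k Int.* den h) ⟨
        ι (num h Int.* den k Int.+ num k Int.* den h)           ∎
    ; residual = by (den k ⊙ residual h ⊞ den h ⊙ residual k) (identity a b (num h) (den h) (num k) (den k))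
    }
    where
    open ≡-Reasoning
    expand : ∀ x y b d → (x + y) * (b * d) ≡ x * b * d + y * d * b
    expand = ℚS.solve 4 (λ x y b d → (x ℚS.:+ y) ℚS.:* (b ℚS.:* d) ℚS.:= x ℚS.:* b ℚS.:* d ℚS.:+ y ℚS.:* d ℚS.:* b) refl
    identity : ∀ a b n d n′ d′ → n Int.* d′ Int.+ n′ Int.* d Int.- (a Int.+ b) Int.* (d Int.* d′)
      ≡ d′ Int.* (n Int.- a Int.* d) Int.+ d Int.* (n′ Int.- b Int.* d′)
    identity = solve-∀

  *-↦ : x ↦ a → y ↦ b → x * y ↦ a Int.* b
  *-↦ {x} {a} {y} {b} h k = record
    { num      = num h Int.* num k
    ; den      = den h Int.* den k
    ; den≉0    = *≉0 (den≉0 h) (den≉0 k)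
    ; fraction = begin
        x * y * ι (den h Int.* den k)          ≡⟨ cong (x * y *_) (ι-* (den h) (den k)) ⟩
        x * y * (ι (den h) * ι (den k))        ≡⟨ interchange x y (ι (den h)) (ι (den k)) ⟩
        x * ι (den h) * (y * ι (den k))        ≡⟨ cong₂ _*_ (fraction h) (fraction k) ⟩
        ι (num h) * ι (num k)                  ≡⟨ ι-* (num h) (num k) ⟨
        ι (num h Int.* num k)                  ∎
    ; residual = by (num k ⊙ residual h ⊞ (a Int.* den h) ⊙ residual k) (identity a b (num h) (den h) (num k) (den k))
    }
    where
    open ≡-Reasoning
    interchange : ∀ x y b d → x * y * (b * d) ≡ x * b * (y * d)
    interchange = ℚS.solve 4 (λ x y b d → x ℚS.:* y ℚS.:* (b ℚS.:* d) ℚS.:= x ℚS.:* b ℚS.:* (y ℚS.:* d)) refl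
    identity : ∀ a b n d n′ d′ → n Int.* n′ Int.- a Int.* b Int.* (d Int.* d′)
      ≡ n′ Int.* (n Int.- a Int.* d) Int.+ a Int.* d Int.* (n′ Int.- b Int.* d′)
    identity = solve-∀

  neg-↦ : x ↦ a → - x ↦ Int.- a
  neg-↦ {x} {a} h = record
    { num = Int.- num h ; den = den h ; den≉0 = den≉0 h
    ; fraction = trans (sym (ℚP.neg-distribˡ-* x (ι (den h)))) (trans (cong -_ (fraction h)) (sym (ι-neg (num h))))
    ; residual = by ((Int.- + 1) ⊙ residual h) (identity a (num h) (den h))
    }
    where
    identity : ∀ a n d → Int.- n Int.- (Int.- a) Int.* d ≡ (Int.- + 1) Int.* (n Int.- a Int.* d)
    identity = solve-∀

  minus-↦ : x ↦ a → y ↦ b → x - y ↦ a Int.- b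
  minus-↦ h k = +-↦ h (neg-↦ k)

  div-↦ : x ↦ a → y ↦ b → ¬ b ≈ + 0 → a ≈ e Int.* b → div x y ↦ e
  div-↦ {x} {a} {y} {b} {e} h k b≉0 a≈eb with y ℚP.≟ 0ℚ
  -- The default value of `div` is never reached: y = 0 forces the numerator to be 0, yet it is
  -- congruent to a product of two invertible residues.
  ... | yes y≡0 = ⊥-elim (num≉0 (≈-reflexive (ι-injective (trans (sym (fraction k))
          (trans (cong (_* ι (den k)) y≡0) (ℚP.*-zeroˡ (ι (den k))))))))
    where
    num≉0 : ¬ num k ≈ + 0
    num≉0 n≈0 = *≉0 b≉0 (den≉0 k) (≈-trans (≈-sym (residual k)) n≈0)
  ... | no y≢0 = record
    { num      = num h Int.* den k
    ; den      = den h Int.* num k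
    ; den≉0    = *≉0 (den≉0 h) (λ n≈0 → *≉0 b≉0 (den≉0 k) (≈-trans (≈-sym (residual k)) n≈0))
    ; fraction = begin
        x * y⁻¹ * ι (den h Int.* num k)                  ≡⟨ cong (x * y⁻¹ *_) (trans (ι-* (den h) (num k)) (cong (ι (den h) *_) (sym (fraction k)))) ⟩
        x * y⁻¹ * (ι (den h) * (y * ι (den k)))          ≡⟨ rearrange x y⁻¹ y (ι (den h)) (ι (den k)) ⟩
        x * ι (den h) * ι (den k) * (y⁻¹ * y)            ≡⟨ cong₂ (λ u v → u * ι (den k) * v) (fraction h) (ℚP.*-inverseˡ y {{Rat.≢-nonZero y≢0}}) ⟩
        ι (num h) * ι (den k) * 1ℚ                       ≡⟨ ℚP.*-identityʳ (ι (num h) * ι (den k)) ⟩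
        ι (num h) * ι (den k)                            ≡⟨ ι-* (num h) (den k) ⟨
        ι (num h Int.* den k)                            ∎
    ; residual = by (den k ⊙ residual h ⊞ (den h Int.* den k) ⊙ a≈eb ⊞ (Int.- (e Int.* den h)) ⊙ residual k)
        (identity a b e (num h) (den h) (num k) (den k))
    }
    where
    open ≡-Reasoning
    y⁻¹ : ℚ
    y⁻¹ = Rat.1/_ y {{Rat.≢-nonZero y≢0}}
    rearrange : ∀ x z y b d → x * z * (b * (y * d)) ≡ x * b * d * (z * y)
    rearrange = ℚS.solve 5 (λ x z y b d → x ℚS.:* z ℚS.:* (b ℚS.:* (y ℚS.:* d)) ℚS.:= x ℚS.:* b ℚS.:* d ℚS.:* (z ℚS.:* y)) refl
    identity : ∀ a b e n d n′ d′ → n Int.* d′ Int.- e Int.* (d Int.* n′)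
      ≡ d′ Int.* (n Int.- a Int.* d) Int.+ d Int.* d′ Int.* (a Int.- e Int.* b)
      Int.+ (Int.- (e Int.* d)) Int.* (n′ Int.- b Int.* d′)
    identity = solve-∀

  pow-↦ : ∀ n → x ↦ a → pow x n ↦ a Int.^ n
  pow-↦ zero    h = ι-↦ (+ 1)
  pow-↦ (suc n) h = *-↦ h (pow-↦ n h)

  sum1-↦ : ∀ n {f : ℕ → ℚ} (g : ℕ → ℤ) → (∀ k → f (suc k) ↦ g (suc k)) → sum1 n f ↦ Σ< n (λ k → g (suc k))
  sum1-↦ zero    g h = ι-↦ (+ 0)
  sum1-↦ (suc n) g h = +-↦ (sum1-↦ n g h) (h n)

  -- The congruence on rationals inspects lowest terms, whereas `z ↦ a` knows some fraction;
  -- cross-multiplication transfers divisibility because p does not divide its denominator.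
  ↦-numerator : ∀ z → z ↦ a → a ≈ + 0 → p ℕD.∣ ∣ Rat.↥ z ∣
  ↦-numerator {a} z h a≈0 = ≈0⇒∣ (*-cancel-≈0 (den h) (Rat.↥ z) (den≉0 h)
    (≈-trans (≈-reflexive (trans (ℤP.*-comm (den h) (Rat.↥ z)) (cross-multiply z (num h) (den h) (fraction h))))
      (by (Rat.↧ z ⊙ residual h ⊞ (Rat.↧ z Int.* den h) ⊙ a≈0) (identity a (num h) (den h) (Rat.↧ z)))))
    where
    identity : ∀ a n d z → n Int.* z Int.- + 0 ≡ z Int.* (n Int.- a Int.* d) Int.+ z Int.* d Int.* (a Int.- + 0)
    identity = solve-∀

  ↦⇒≡ : x ↦ a → y ↦ b → a ≈ b → x ≡ y [modℚ p ]
  ↦⇒≡ {x} {a} {y} h k a≈b = ↦-numerator (x - y) (minus-↦ h k) (≈⇒-≈0 a≈b)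

  reduce : ∀ x → InD p x → ∃ λ a → x ↦ a
  reduce x p∤x = Rat.↥ x Int.* proj₁ inv , record
    { num = Rat.↥ x ; den = Rat.↧ x ; den≉0 = den≉0′ ; fraction = *-denominator x
    ; residual = by ((Int.- Rat.↥ x) ⊙ proj₂ inv) (identity (Rat.↥ x) (Rat.↧ x) (proj₁ inv)) }
    where
    den≉0′ : ¬ Rat.↧ x ≈ + 0
    den≉0′ h = p∤x (≈0⇒∣ h)
    inv = inverse (Rat.↧ x) den≉0′
    identity : ∀ n d i → n Int.- n Int.* i Int.* d ≡ (Int.- n) Int.* (d Int.* i Int.- + 1)
    identity = solve-∀

  -- If p divided the reduced denominator, cross-multiplication would make it divide the reduced
  -- numerator too, against coprimality.
  ↦-denominator : ∀ z → z ↦ a → ¬ Rat.↧ z ≈ + 0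
  ↦-denominator z@(Rat.mkℚ n d-1 coprime) h d≈0 = ⊥-elim-irr (ℕP.<⇒≢ 1<p (sym (coprime (p∣n , ≈0⇒∣ d≈0))))
    where
    p∣n : p ℕD.∣ ∣ n ∣
    p∣n = ≈0⇒∣ (*-cancel-≈0 (den h) n (den≉0 h)
      (≈-trans (≈-reflexive (trans (ℤP.*-comm (den h) n) (cross-multiply z (num h) (den h) (fraction h))))
        (≈-trans (*-congˡ (num h) d≈0) (≈-reflexive (ℤP.*-zeroʳ (num h))))))

  -- For z = n/d in lowest terms n d ≡ a d², and the square disappears in the m-th power since
  -- d^(p-1) ≡ 1.
  legendre-↦ : ∀ z → z ↦ a → legendre z p ↦ a Int.^ m
  legendre-↦ {a} z h = record
    { num = L ; den = + 1 ; den≉0 = +1≉0 ; fraction = ℚP.*-identityʳ (ι L)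
    ; residual = ≈-trans (≈-trans (legendreℤ≈^ (n Int.* d)) power) (≈-reflexive (sym (ℤP.*-identityʳ (a Int.^ m)))) }
    where
    open ≈-Reasoning
    n d L : ℤ
    n = Rat.↥ z
    d = Rat.↧ z
    L = legendreℤ p (n Int.* d)
    n≈ad : n ≈ a Int.* d
    n≈ad = *-cancelˡ (den h) n (a Int.* d) (den≉0 h)
      (≈-trans (≈-reflexive (trans (ℤP.*-comm (den h) n) (cross-multiply z (num h) (den h) (fraction h))))
        (by (d ⊙ residual h) (identity a (num h) (den h) d)))
      where
      identity : ∀ a n b d → n Int.* d Int.- b Int.* (a Int.* d) ≡ d Int.* (n Int.- a Int.* b)
      identity = solve-∀
    power : (n Int.* d) Int.^ m ≈ a Int.^ m
    power = begin
      (n Int.* d) Int.^ m                      ≈⟨ ^-cong m (*-congʳ d n≈ad) ⟩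
      (a Int.* d Int.* d) Int.^ m              ≡⟨ cong (Int._^ m) (ℤP.*-assoc a d d) ⟩
      (a Int.* (d Int.* d)) Int.^ m            ≡⟨ ^-distribʳ-* a (d Int.* d) m ⟩
      a Int.^ m Int.* (d Int.* d) Int.^ m      ≡⟨ cong (a Int.^ m Int.*_) (square-^ d m) ⟩
      a Int.^ m Int.* d Int.^ (m ℕ.+ m)        ≈⟨ *-congˡ (a Int.^ m) (fermat′ d (↦-denominator z h)) ⟩
      a Int.^ m Int.* + 1                      ≡⟨ ℤP.*-identityʳ (a Int.^ m) ⟩
      a Int.^ m                                ∎

  -- The residue of the quotient is exposed only through b e ≡ a, which suffices once a congruence
  -- has been multiplied by b.
  quotient-↦ : ∀ x y a b → x ↦ a → y ↦ b → ¬ b ≈ + 0 → ∃ λ e → (b Int.* e ≈ a) × (div x y ↦ e)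
  quotient-↦ x y a b x↦a y↦b b≉0 = a Int.* i , by (a ⊙ bi≈1) (identity a b i) ,
      div-↦ {x} {a} {y} {b} {a Int.* i} x↦a y↦b b≉0 (by ((Int.- a) ⊙ bi≈1) (identity′ a b i))
    where
    i : ℤ
    i = proj₁ (inverse b b≉0)
    bi≈1 : b Int.* i ≈ + 1
    bi≈1 = proj₂ (inverse b b≉0)
    identity : ∀ a b i → b Int.* (a Int.* i) Int.- a ≡ a Int.* (b Int.* i Int.- + 1)
    identity = solve-∀
    identity′ : ∀ a b i → a Int.- a Int.* i Int.* b ≡ (Int.- a) Int.* (b Int.* i Int.- + 1)
    identity′ = solve-∀

C2≡catalan : ∀ k → C2 (suc k) ≡ ι (catalan (suc k))
C2≡catalan k = ℚP.fromℚᵘ-cong {ℚᵘ.mkℚᵘ (central (suc k)) (2 ℕ.* suc k)} {ℚᵘ.mkℚᵘ (catalan (suc k)) 0}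
  (ℚᵘ.*≡* (trans (ℤP.*-identityʳ (central (suc k))) (sym (catalan-* k))))

odd-prime : ∀ {p} → Prime p → p > 3 → ∃ λ m → 0 ℕ.< m × p ≡ suc (m ℕ.+ m)
odd-prime {p} p-prime p>3 with p ℕ.% 2 in eq | ℕDM.m%n<n p 2
... | 0 | _ = ⊥-elim ([ (λ ()) , (λ { refl → ℕP.<⇒≱ p>3 (s≤s (s≤s z≤n)) }) ]′
                (prime⇒irreducible p-prime (ℕD.m%n≡0⇒n∣m p 2 eq)))
... | 1 | _ = m , ℕDM.m≥n⇒m/n>0 (ℕP.≤-trans (s≤s (s≤s z≤n)) p>3) ,
    trans (ℕDM.m≡m%n+[m/n]*n p 2) (trans (cong (ℕ._+ m ℕ.* 2) eq) (cong suc (double m)))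
  where
  m : ℕ
  m = p ℕ./ 2
  double : ∀ m → m ℕ.* 2 ≡ m ℕ.+ m
  double = ℕR.solve-∀
... | suc (suc _) | s≤s (s≤s ())

-- Transfer of the integer congruences to rational t.

module Conclusion (p : ℕ) (p-prime : Prime p) (p>3 : p > 3) (m : ℕ) (0<m : 0 ℕ.< m) (p≡1+2m : p ≡ suc (m ℕ.+ m))
                  (t : ℚ) (τ : ℤ) (t↦τ : Reduction._↦_ p p-prime m 0<m p≡1+2m t τ) where
  open Reduction p p-prime m 0<m p≡1+2m
  open Evaluation p p-prime p>3 m 0<m p≡1+2m τ
  open Rat using (_+_; _*_; _-_)

  1-↦ : 1ℚ ↦ + 1
  1-↦ = ι-↦ (+ 1)

  x-↦ : t * t * (t + 1ℚ) ↦ x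
  x-↦ = *-↦ (*-↦ t↦τ t↦τ) (+-↦ t↦τ 1-↦)

  1+t-↦ : 1ℚ + t ↦ + 1 Int.+ τ
  1+t-↦ = +-↦ 1-↦ t↦τ

  1-3t-↦ : 1ℚ - q 3 * t ↦ + 1 Int.- + 3 Int.* τ
  1-3t-↦ = minus-↦ 1-↦ (*-↦ (ι-↦ (+ 3)) t↦τ)

  2t-↦ : q 2 * t ↦ + 2 Int.* τ
  2t-↦ = *-↦ (ι-↦ (+ 2)) t↦τ

  3t+2-↦ : q 3 * t + q 2 ↦ + 3 Int.* τ Int.+ + 2
  3t+2-↦ = +-↦ (*-↦ (ι-↦ (+ 3)) t↦τ) (ι-↦ (+ 2))

  3[t+1]-↦ : q 3 * (t + 1ℚ) ↦ + 3 Int.* (τ Int.+ + 1)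
  3[t+1]-↦ = *-↦ (ι-↦ (+ 3)) (+-↦ t↦τ 1-↦)

  legendre-D : legendre ((1ℚ + t) * (1ℚ - q 3 * t)) p ↦ E
  legendre-D = legendre-↦ ((1ℚ + t) * (1ℚ - q 3 * t)) (*-↦ 1+t-↦ 1-3t-↦)

  catalan-sum-↦ : ∀ n → sum1 n (λ k → C2 k * pow (t * t * (t + 1ℚ)) k) ↦ tail catalan n
  catalan-sum-↦ n = sum1-↦ n (weighted catalan)
    (λ k → *-↦ (subst (_↦ catalan (suc k)) (sym (C2≡catalan k)) (ι-↦ (catalan (suc k)))) (pow-↦ (suc k) x-↦))

  binomial-sum-↦ : ∀ n → sum1 n (λ k → binom3 k * pow (t * t * (t + 1ℚ)) k) ↦ tail central n
  binomial-sum-↦ n = sum1-↦ n (weighted central) (λ k → *-↦ (ι-↦ (central (suc k))) (pow-↦ (suc k) x-↦))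

  module _ (t≢0 : ¬ (t ≡ 0ℚ [modℚ p ])) where

    τ≉0 : ¬ τ ≈ + 0
    τ≉0 h = t≢0 (↦⇒≡ t↦τ (ι-↦ (+ 0)) h)

    2τ≉0 : ¬ + 2 Int.* τ ≈ + 0
    2τ≉0 = *≉0 +2≉0 τ≉0

    catalan-short-ℚ : sum1 (p ℕ./ 3) (λ k → C2 k * pow (t * t * (t + 1ℚ)) k)
      ≡ div (1ℚ + t) (q 2 * t) - div (1ℚ - q 3 * t) (q 2 * t) * legendre ((1ℚ + t) * (1ℚ - q 3 * t)) p [modℚ p ]
    catalan-short-ℚ =
      let (e , be≈ , d↦e) = quotient-↦ _ _ _ _ 1+t-↦ 2t-↦ 2τ≉0
          (e′ , be′≈ , d′↦e′) = quotient-↦ _ _ _ _ 1-3t-↦ 2t-↦ 2τ≉0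
      in ↦⇒≡ (catalan-sum-↦ (p ℕ./ 3)) (minus-↦ d↦e (*-↦ d′↦e′ legendre-D))
      (*-cancelˡ (+ 2 Int.* τ) (tail catalan (p ℕ./ 3)) (e Int.- e′ Int.* E) 2τ≉0
        (by (+ 1 ⊙ catalan-short τ≉0 ⊞ (Int.- + 1) ⊙ be≈ ⊞ E ⊙ be′≈)
          (identity (+ 2 Int.* τ) (+ 1 Int.+ τ) (+ 1 Int.- + 3 Int.* τ) (tail catalan (p ℕ./ 3)) e e′ E)))
      where
      identity : ∀ b u v s e e′ l → b Int.* s Int.- b Int.* (e Int.- e′ Int.* l)
        ≡ + 1 Int.* (b Int.* s Int.- (u Int.- v Int.* l)) Int.+ (Int.- + 1) Int.* (b Int.* e Int.- u) Int.+ l Int.* (b Int.* e′ Int.- v)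
      identity = solve-∀

    catalan-full-ℚ : sum1 (p ∸ 1) (λ k → C2 k * pow (t * t * (t + 1ℚ)) k)
      ≡ div ((1ℚ + t) * (1ℚ - q 3 * t)) (q 2 * t) * (1ℚ - legendre ((1ℚ + t) * (1ℚ - q 3 * t)) p) [modℚ p ]
    catalan-full-ℚ =
      let (e , be≈ , d↦e) = quotient-↦ _ _ _ _ (*-↦ 1+t-↦ 1-3t-↦) 2t-↦ 2τ≉0
      in ↦⇒≡ (catalan-sum-↦ (p ∸ 1)) (*-↦ d↦e (minus-↦ 1-↦ legendre-D))
      (*-cancelˡ (+ 2 Int.* τ) (tail catalan (p ∸ 1)) (e Int.* (+ 1 Int.- E)) 2τ≉0
        (by (+ 1 ⊙ catalan-full τ≉0 ⊞ (Int.- (+ 1 Int.- E)) ⊙ be≈)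
          (identity (+ 2 Int.* τ) D (tail catalan (p ∸ 1)) e (+ 1 Int.- E))))
      where
      identity : ∀ b u s e l → b Int.* s Int.- b Int.* (e Int.* l)
        ≡ + 1 Int.* (b Int.* s Int.- u Int.* l) Int.+ (Int.- l) Int.* (b Int.* e Int.- u)
      identity = solve-∀

  module _ (3t+2≢0 : ¬ (q 3 * t + q 2 ≡ 0ℚ [modℚ p ])) where

    2[3τ+2] : ℤ
    2[3τ+2] = + 2 Int.* (+ 3 Int.* τ Int.+ + 2)

    2[3τ+2]≉0 : ¬ 2[3τ+2] ≈ + 0
    2[3τ+2]≉0 = *≉0 +2≉0 (λ h → 3t+2≢0 (↦⇒≡ 3t+2-↦ (ι-↦ (+ 0)) h))

    2[3t+2]-↦ : q 2 * (q 3 * t + q 2) ↦ 2[3τ+2]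
    2[3t+2]-↦ = *-↦ (ι-↦ (+ 2)) 3t+2-↦

    identity : ∀ b u s e l → b Int.* s Int.- b Int.* (e Int.* l)
      ≡ + 1 Int.* (b Int.* s Int.- u Int.* l) Int.+ (Int.- l) Int.* (b Int.* e Int.- u)
    identity = solve-∀

    binomial-short-ℚ : sum1 (p ℕ./ 3) (λ k → binom3 k * pow (t * t * (t + 1ℚ)) k)
      ≡ div (q 3 * (t + 1ℚ)) (q 2 * (q 3 * t + q 2)) * (legendre ((1ℚ + t) * (1ℚ - q 3 * t)) p - 1ℚ) [modℚ p ]
    binomial-short-ℚ =
      let (e , be≈ , d↦e) = quotient-↦ _ _ _ _ 3[t+1]-↦ 2[3t+2]-↦ 2[3τ+2]≉0
      in ↦⇒≡ (binomial-sum-↦ (p ℕ./ 3)) (*-↦ d↦e (minus-↦ legendre-D 1-↦))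
      (*-cancelˡ 2[3τ+2] (tail central (p ℕ./ 3)) (e Int.* (E Int.- + 1)) 2[3τ+2]≉0
        (by (+ 1 ⊙ binomial-short ⊞ (Int.- (E Int.- + 1)) ⊙ be≈)
          (identity 2[3τ+2] (+ 3 Int.* (τ Int.+ + 1)) (tail central (p ℕ./ 3)) e (E Int.- + 1))))

    binomial-full-ℚ : sum1 (p ∸ 1) (λ k → binom3 k * pow (t * t * (t + 1ℚ)) k)
      ≡ div (q 3 * (t + 1ℚ) * (t + 1ℚ)) (q 2 * (q 3 * t + q 2)) * (legendre ((1ℚ + t) * (1ℚ - q 3 * t)) p - 1ℚ) [modℚ p ]
    binomial-full-ℚ =
      let (e , be≈ , d↦e) = quotient-↦ _ _ _ _ (*-↦ 3[t+1]-↦ (+-↦ t↦τ 1-↦)) 2[3t+2]-↦ 2[3τ+2]≉0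
      in ↦⇒≡ (binomial-sum-↦ (p ∸ 1)) (*-↦ d↦e (minus-↦ legendre-D 1-↦))
      (*-cancelˡ 2[3τ+2] (tail central (p ∸ 1)) (e Int.* (E Int.- + 1)) 2[3τ+2]≉0
        (by (+ 1 ⊙ binomial-full ⊞ (Int.- (E Int.- + 1)) ⊙ be≈)
          (identity 2[3τ+2] (+ 3 Int.* (τ Int.+ + 1) Int.* (τ Int.+ + 1)) (tail central (p ∸ 1)) e (E Int.- + 1))))

open Rat using (_+_; _*_; _-_)

theorem21 : (p : ℕ) → Prime p → p > 3 → (t : ℚ) → InD p t →
    (¬ (t ≡ 0ℚ [modℚ p ]) →
    (sum1 (p ℕ./ 3) (λ k → C2 k * pow (t * t * (t + 1ℚ)) k)
    ≡ div (1ℚ + t) (q 2 * t) - div (1ℚ - q 3 * t) (q 2 * t) * legendre ((1ℚ + t) * (1ℚ - q 3 * t)) p [modℚ p ])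
    × (sum1 (p ∸ 1) (λ k → C2 k * pow (t * t * (t + 1ℚ)) k)
    ≡ div ((1ℚ + t) * (1ℚ - q 3 * t)) (q 2 * t) * (1ℚ - legendre ((1ℚ + t) * (1ℚ - q 3 * t)) p) [modℚ p ]))
    × (¬ (q 3 * t + q 2 ≡ 0ℚ [modℚ p ]) →
    (sum1 (p ℕ./ 3) (λ k → binom3 k * pow (t * t * (t + 1ℚ)) k)
    ≡ div (q 3 * (t + 1ℚ)) (q 2 * (q 3 * t + q 2)) * (legendre ((1ℚ + t) * (1ℚ - q 3 * t)) p - 1ℚ) [modℚ p ])
    × (sum1 (p ∸ 1) (λ k → binom3 k * pow (t * t * (t + 1ℚ)) k)
    ≡ div (q 3 * (t + 1ℚ) * (t + 1ℚ)) (q 2 * (q 3 * t + q 2)) * (legendre ((1ℚ + t) * (1ℚ - q 3 * t)) p - 1ℚ) [modℚ p ]))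
theorem21 p p-prime p>3 t t∈D_p =
  let (m , 0<m , p≡1+2m) = odd-prime p-prime p>3
      (τ , t↦τ) = Reduction.reduce p p-prime m 0<m p≡1+2m t t∈D_p
      open Conclusion p p-prime p>3 m 0<m p≡1+2m t τ t↦τ
  in (λ t≢0 → catalan-short-ℚ t≢0 , catalan-full-ℚ t≢0)
   , (λ 3t+2≢0 → binomial-short-ℚ 3t+2≢0 , binomial-full-ℚ 3t+2≢0)
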